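{- Let $a$ be a weak composition with exactly two nonzero parts and at least two leading zeros (that is, $a_1=a_2=0$). Then $\kappa_a$ is multiplicity free if and only if either (1) $\mathrm{sort}(a)$ is one of the partitions $(3,3)$, $(4,4)$, $(n-2,2)$ for some $n\ge 4$, or $(n-1,1)$ for some $n\ge 2$; or (2) $\mathrm{flat}(a)=(4,3)$.
   Context: A weak composition $a=(a_1,\dots,a_\ell)$ of length $\ell$ is a finite sequence of nonnegative integers. $\mathrm{flat}(a)$ is the sequence obtained by deleting the zeros of $a$, and $\mathrm{sort}(a)$ is the partition obtained by rearranging the parts of $\mathrm{flat}(a)$ in weakly decreasing order. A diagram is a finite set of cells $(r,c)$ with $r,c$ positive integers (row $r$ from the bottom, column $c$ from the left). A Kohnert tableau of content $a$ is a diagram filled with positive integers, exactly $a_i$ cells containing $i$ for each $i$, such that: (i) for each $i$ there is exactly one $i$ in each of the columns $1,\dots,a_i$; (ii) every entry in row $r$ is at least $r$; (iii) for each $i$, the cells containing $i$ weakly descend from left to right; (iv) if $i<j$ appear in the same column with $i$ above $j$, then there is an $i$ in the column immediately to the right of the cell containing that $j$, in a row strictly above it. It is quasi-Yamanouchi if moreover (v) for each nonempty row $r$, either row $r$ contains an entry equal to $r$, or some cell of row $r+1$ lies weakly to the right of some cell of row $r$. Let $\mathrm{QKT}(a)$ be the set of quasi-Yamanouchi Kohnert tableaux of content $a$, and $\mathrm{wt}(T)$ the weak composition of length $\ell$ whose $r$-th part is the number of cells in row $r$ of $T$. The key polynomial $\kappa_a$ satisfies $\kappa_a=\sum_{T\in\mathrm{QKT}(a)}\mathfrak{F}_{\mathrm{wt}(T)}$,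 where $\mathfrak{F}_b$ is the fundamental slide polynomial. We say $\kappa_a$ is multiplicity free if distinct tableaux in $\mathrm{QKT}(a)$ have distinct weights. -}

module Defs where

open import Data.Nat using (ℕ; zero; suc; _+_; _≤_; _<_; _≤ᵇ_)
open import Data.Bool using (Bool; true; false; if_then_else_)
open import Data.List using (List; []; _∷_; length; map; upTo)
open import Data.Nat.ListAction using (sum)
open import Data.Maybe using (Maybe; just; nothing; is-just)
open import Data.Product using (Σ; _×_; _,_; ∃; ∃-syntax)
open import Data.Sum using (_⊎_)
open import Relation.Binary.PropositionalEquality using (_≡_)

WeakComposition : Set
WeakComposition = List ℕ

-- 1-indexed part a_i (0 outside 1..ℓ)
part : WeakComposition → ℕ → ℕ
part []       _             = 0
part (x ∷ xs) zero          = 0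
part (x ∷ xs) (suc zero)    = x
part (x ∷ xs) (suc (suc i)) = part xs (suc i)

flat : WeakComposition → List ℕ
flat []             = []
flat (zero ∷ xs)    = flat xs
flat (suc x ∷ xs)   = suc x ∷ flat xs

insertDesc : ℕ → List ℕ → List ℕ
insertDesc x []       = x ∷ []
insertDesc x (y ∷ ys) = if y ≤ᵇ x then x ∷ y ∷ ys else y ∷ insertDesc x ys

sortDesc : List ℕ → List ℕ
sortDesc []       = []
sortDesc (x ∷ xs) = insertDesc x (sortDesc xs)

sortC : WeakComposition → List ℕ
sortC a = sortDesc (flat a)

-- A filled diagram: T r c = just i means cell (r,c) is in the diagram and
-- contains i; T r c = nothing means (r,c) is not a cell.
-- (row r counted from the bottom, column c from the left, both ≥ 1)
Filling : Set
Filling = ℕ → ℕ → Maybe ℕ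

IsCell : Filling → ℕ → ℕ → Set
IsCell T r c = ∃[ i ] T r c ≡ just i

record IsKohnertTableau (a : WeakComposition) (T : Filling) : Set where
  field
    support   : ∀ r c i → T r c ≡ just i → 1 ≤ r × 1 ≤ c × 1 ≤ i × i ≤ length a
    colExists : ∀ i c → 1 ≤ i → i ≤ length a → 1 ≤ c → c ≤ part a i →
                ∃[ r ] T r c ≡ just i
    colUnique : ∀ i c r r' → T r c ≡ just i → T r' c ≡ just i → r ≡ r'
    colRange  : ∀ i c r → T r c ≡ just i → c ≤ part a i
    rowBound  : ∀ r c i → T r c ≡ just i → r ≤ i
    descend   : ∀ i r c r' c' → T r c ≡ just i → T r' c' ≡ just i → c < c' → r' ≤ r
    inversion : ∀ i j c r r' → T r c ≡ just i → T r' c ≡ just j → i < j → r' < r →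
                ∃[ r'' ] (r' < r'' × T r'' (suc c) ≡ just i)

IsQuasiYamanouchi : Filling → Set
IsQuasiYamanouchi T =
  ∀ r → (∃[ c ] IsCell T r c) →
    (∃[ c ] T r c ≡ just r)
    ⊎ (∃[ c ] ∃[ c' ] (IsCell T r c × IsCell T (suc r) c' × c ≤ c'))

IsQKT : WeakComposition → Filling → Set
IsQKT a T = IsKohnertTableau a T × IsQuasiYamanouchi T

-- number of cells in row r; every cell of a Kohnert tableau of content a lies
-- in a column c ≤ a_i ≤ sum a, so it suffices to scan columns 1..sum a
rowCount : WeakComposition → Filling → ℕ → ℕ
rowCount a T r = sum (map (λ c → if is-just (T r c) then 1 else 0) (map suc (upTo (sum a))))

wt : WeakComposition → Filling → WeakComposition
wt a T = map (λ r → rowCount a T r) (map suc (upTo (length a)))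

MultiplicityFree : WeakComposition → Set
MultiplicityFree a =
  ∀ T T' → IsQKT a T → IsQKT a T' → wt a T ≡ wt a T' → ∀ r c → T r c ≡ T' r c

{-# OPTIONS --safe #-}
-- A tableau with two nonzero parts, at p < q, is a pair of weakly descending paths:
-- f through the cells containing p and g through those containing q. The
-- quasi-Yamanouchi condition forces f to start in row p, and it forces every occupied
-- row below p to be supported by a cell of the other path in the row above. Since a
-- descending path is determined by its row counts, the weight together with one of the
-- paths determines the other one. If one part is at most 2, its path can be read off the
-- weight. In general only the depths below row p matter, and they are smaller than the
-- number of cells, so (3,3), (4,4) and (4,3) are settled by a finite search. In all other
-- cases there are two tableaux of the same weight that differ in a few columns and use
-- only the rows q, p, p-1 and p-2; this is where the two leading zeros enter.
module Submission where

open import Defs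
open import Data.Bool using (true; false; T; if_then_else_)
open import Data.Empty using (⊥; ⊥-elim)
open import Data.Fin as Fin using (Fin; toℕ; fromℕ<; splitAt; _↑ˡ_; _↑ʳ_)
open import Data.Fin.Properties using (toℕ-fromℕ<; toℕ<n; splitAt-↑ˡ; splitAt-↑ʳ; pigeonhole)
open import Data.List using (List; []; _∷_; _++_; length; map; replicate; cartesianProduct; filter; upTo; applyUpTo)
open import Data.List.Membership.Propositional using (_∈_)
open import Data.List.Membership.Propositional.Properties using (∈-++⁺ˡ; ∈-++⁺ʳ; ∈-map⁺; ∈-filter⁺; ∈-cartesianProduct⁺)
open import Data.List.Properties using (length-++; length-replicate; map-++; map-cong; map-∘; ∷-injective; ≡-dec)
open import Data.List.Relation.Unary.All as All using (All; []; _∷_; all?)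
open import Data.List.Relation.Unary.All.Properties using (++⁺; replicate⁺)
open import Data.List.Relation.Unary.Any using (here; there)
open import Data.List.Relation.Unary.Linked using (Linked; []; [-]; _∷_; linked?)
open import Data.Maybe using (Maybe; just; nothing; is-just)
open import Data.Maybe.Properties using (just-injective)
open import Data.Nat hiding (_^_)
open import Data.Nat.ListAction using (sum)
open import Data.Nat.ListAction.Properties using (sum-++)
open import Data.Nat.Properties
open import Data.Nat.Tactic.RingSolver using (solve-∀)
open import Data.Product using (_×_; _,_; ∃-syntax; proj₁; proj₂)
open import Data.Sum using (_⊎_; inj₁; inj₂; [_,_]′)
open import Data.Unit using (⊤; tt)
open import Function using (_∘_; id)
open import Function.Bundles using (_⇔_; mk⇔; Equivalence)
open import Relation.Binary.Definitions using (tri<; tri≈; tri>)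
open import Relation.Binary.PropositionalEquality
open import Relation.Nullary using (¬_; Dec; yes; no; contradiction)
open import Relation.Nullary.Decidable using (True; toWitness; from-yes; ¬?; _×-dec_; _→-dec_; _⊎-dec_)
open import Data.List.Membership.DecPropositional _≟_ using (_∈?_)
open import Algebra.Properties.CommutativeSemigroup +-commutativeSemigroup using (interchange)

-- Tableaux as pairs of paths

-- The two paths are not interchangeable, because of condition (iv): once the upper path is below
-- the lower one, it stays below, and the lower path outlasts it. So for x ≤ y the upper path never
-- passes under the lower one, and every row below p is supported from a lower cell to an upper
-- cell. For x > y both configurations occur, which makes the order of the parts matter.
--
-- A search must not depend on p and q. No row strictly between them is occupied: only the upper
-- path could reach it, and the lower path could not support it. Rows can therefore be renamed by
-- codes that increase downwards, and a tableau becomes a pair of weakly increasing lists in which p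
-- and q no longer occur. Occupied rows below p form an unbroken run up to p, which bounds the codes
-- by the number of cells. The counterexamples are written in the same codes, and none exceeds 3.
--
-- Counterexamples extend to families because repeating a common first column adds the same cells to
-- both weights and creates no new constraint; a path that is strictly longer can also be prolonged
-- in its last row.

flat≡[] : ∀ a → flat a ≡ [] → (∀ i → part a i ≡ 0) × sum a ≡ 0
flat≡[] []         _ = (λ _ → refl) , refl
flat≡[] (zero ∷ a) e with flat≡[] a e
... | z , s = (λ { zero → refl ; (suc zero) → refl ; (suc (suc i)) → z (suc i) }) , s

record OnePart (a : WeakComposition) (q y : ℕ) : Set where
  field
    1≤q   : 1 ≤ q
    q≤ℓ   : q ≤ length a
    at-q  : part a q ≡ y
    other : ∀ i → i ≢ q → part a i ≡ 0
    total : sum a ≡ y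

flat≡[y] : ∀ a {y} → flat a ≡ y ∷ [] → ∃[ q ] OnePart a q y
flat≡[y] (zero ∷ a) e with flat≡[y] a e
... | suc q , o = suc (suc q) , record
  { 1≤q = s≤s z≤n ; q≤ℓ = s≤s q≤ℓ ; at-q = at-q ; total = total
  ; other = λ { zero _ → refl ; (suc zero) _ → refl
              ; (suc (suc i)) ne → other (suc i) (λ h → ne (cong suc h)) } }
  where open OnePart o
flat≡[y] (suc x ∷ a) e with flat a in eq
flat≡[y] (suc x ∷ a) refl | [] with flat≡[] a eq
... | z , s = 1 , record
  { 1≤q = s≤s z≤n ; q≤ℓ = s≤s z≤n ; at-q = refl
  ; total = trans (cong (suc x +_) s) (+-identityʳ _)
  ; other = λ { zero _ → refl ; (suc zero) ne → ⊥-elim (ne refl) ; (suc (suc i)) _ → z (suc i) } }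

record TwoParts (a : WeakComposition) (p q x y : ℕ) : Set where
  field
    1≤p   : 1 ≤ p
    p<q   : p < q
    q≤ℓ   : q ≤ length a
    at-p  : part a p ≡ x
    at-q  : part a q ≡ y
    other : ∀ i → i ≢ p → i ≢ q → part a i ≡ 0
    total : sum a ≡ x + y

flat≡[x,y] : ∀ a {x y} → flat a ≡ x ∷ y ∷ [] → ∃[ p ] ∃[ q ] TwoParts a p q x y
flat≡[x,y] (zero ∷ a) e with flat≡[x,y] a e
... | suc p , suc q , o = suc (suc p) , suc (suc q) , record
  { 1≤p = s≤s z≤n ; p<q = s≤s p<q ; q≤ℓ = s≤s q≤ℓ ; at-p = at-p ; at-q = at-q ; total = total
  ; other = λ { zero _ _ → refl ; (suc zero) _ _ → refl
              ; (suc (suc i)) ne ne′ → other (suc i) (λ h → ne (cong suc h)) (λ h → ne′ (cong suc h)) } }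
  where open TwoParts o
... | zero , _ , o = contradiction (TwoParts.1≤p o) λ ()
flat≡[x,y] (suc x ∷ a) e with flat a in eq
flat≡[x,y] (suc x ∷ a) refl | y ∷ [] with flat≡[y] a eq
... | zero  , o = contradiction (OnePart.1≤q o) λ ()
... | suc q , o = 1 , suc (suc q) , record
  { 1≤p = s≤s z≤n ; p<q = s≤s (s≤s z≤n) ; q≤ℓ = s≤s q≤ℓ ; at-p = refl ; at-q = at-q
  ; total = cong (suc x +_) total
  ; other = λ { zero _ _ → refl ; (suc zero) ne _ → ⊥-elim (ne refl)
              ; (suc (suc i)) _ ne → other (suc i) (λ h → ne (cong suc h)) } }
  where open OnePart o

-- Columns of a path are numbered from 0, so column c of a path is column suc c
-- of the tableau; the value 0 means that the path has already ended.
record Path (top len : ℕ) (f : ℕ → ℕ) : Set where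
  field
    inside  : ∀ {c} → c < len → 0 < f c
    outside : ∀ {c} → len ≤ c → f c ≡ 0
    descent : ∀ {c d} → c ≤ d → f d ≤ f c
    bounded : ∀ c → f c ≤ top

  inside⁻¹ : ∀ {c} → 0 < f c → c < len
  inside⁻¹ {c} 0<fc with len ≤? c
  ... | yes len≤c = contradiction (outside len≤c) (>⇒≢ 0<fc)
  ... | no  len≰c = ≰⇒> len≰c

At : (f g : ℕ → ℕ) → ℕ → ℕ → Set
At f g r c = f c ≡ r ⊎ g c ≡ r

Occupied : (f g : ℕ → ℕ) → ℕ → Set
Occupied f g r = ∃[ c ] At f g r c

-- Condition (iv) concerns only a smaller entry above a larger one, so it acts only where g is below
-- f. The guards `0 < f c` and `0 < g c` exclude columns in which a path has ended. `supported` is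
-- (v), with the entry equal to its row split by path.
record Paths (p q x y : ℕ) (f g : ℕ → ℕ) : Set where
  field
    lower     : Path p x f
    upper     : Path q y g
    disjoint  : ∀ c → 0 < f c → f c ≢ g c
    crossing  : ∀ c → 0 < g c → g c < f c → g c < f (suc c)
    supported : ∀ r → 0 < r → Occupied f g r →
                (r ≡ p × ∃[ c ] f c ≡ p) ⊎ (r ≡ q × ∃[ c ] g c ≡ q) ⊎
                (∃[ c ] ∃[ d ] (c ≤ d × At f g r c × At f g (suc r) d))

module Tableaux (a : WeakComposition) (p q x y : ℕ) (parts : TwoParts a p q x y) where
  open TwoParts parts
  open IsKohnertTableau

  -- The successors exclude the value 0 of an ended path and translate columns counted from 0 into
  -- columns counted from 1.
  data Entry (f g : ℕ → ℕ) : ℕ → ℕ → ℕ → Set where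
    low : ∀ {r c} → f c ≡ suc r → Entry f g (suc r) (suc c) p
    upp : ∀ {r c} → g c ≡ suc r → Entry f g (suc r) (suc c) q

  Encodes : Filling → (f g : ℕ → ℕ) → Set
  Encodes T f g = ∀ {r c i} → T r c ≡ just i ⇔ Entry f g r c i

  p≤ℓ : p ≤ length a
  p≤ℓ = ≤-trans (<⇒≤ p<q) q≤ℓ

  1≤q : 1 ≤ q
  1≤q = ≤-trans 1≤p (<⇒≤ p<q)

  Entry-p : ∀ {f g r c} → Entry f g r (suc c) p → f c ≡ r
  -- With the index fixed to p, matching on `upp` would have to unify the variables p and q; the
  -- general index turns this into an equation refuted by p < q.
  Entry-p e = go e refl
    where
    go : ∀ {f g r c i} → Entry f g r (suc c) i → i ≡ p → f c ≡ r
    go (low h) _  = h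
    go (upp h) e′ = ⊥-elim (<-irrefl (sym e′) p<q)

  Entry-q : ∀ {f g r c} → Entry f g r (suc c) q → g c ≡ r
  Entry-q e = go e refl
    where
    go : ∀ {f g r c i} → Entry f g r (suc c) i → i ≡ q → g c ≡ r
    go (low h) e′ = ⊥-elim (<-irrefl e′ p<q)
    go (upp h) _  = h

  module Reading {T : Filling} (K : IsKohnertTableau a T) where

    path : (i : ℕ) → 1 ≤ i → i ≤ length a → ℕ → ℕ
    path i 1≤i i≤ℓ c with suc c ≤? part a i
    ... | yes c<n = proj₁ (colExists K i (suc c) 1≤i i≤ℓ (s≤s z≤n) c<n)
    ... | no  _   = 0

    path-cell : ∀ {i} 1≤i i≤ℓ {r c} → path i 1≤i i≤ℓ c ≡ suc r → T (suc r) (suc c) ≡ just i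
    path-cell {i} 1≤i i≤ℓ {r} {c} e with suc c ≤? part a i
    ... | yes c<n = subst (λ s → T s (suc c) ≡ just i) e (proj₂ (colExists K i (suc c) 1≤i i≤ℓ (s≤s z≤n) c<n))

    cell-path : ∀ {i} 1≤i i≤ℓ {r c} → T r (suc c) ≡ just i → path i 1≤i i≤ℓ c ≡ r
    cell-path {i} 1≤i i≤ℓ {r} {c} e with suc c ≤? part a i
    ... | yes c<n = colUnique K i (suc c) _ _ (proj₂ (colExists K i (suc c) 1≤i i≤ℓ (s≤s z≤n) c<n)) e
    ... | no  c≮n = contradiction (colRange K i (suc c) r e) c≮n

    isPath : ∀ {i} 1≤i i≤ℓ {n} → part a i ≡ n → Path i n (path i 1≤i i≤ℓ)
    isPath {i} 1≤i i≤ℓ refl = record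
      { inside = in′ ; outside = out′ ; descent = desc ; bounded = bound }
      where
      f = path i 1≤i i≤ℓ
      in′ : ∀ {c} → c < part a i → 0 < f c
      in′ {c} c<n with suc c ≤? part a i
      ... | yes c<n = proj₁ (support K _ _ _ (proj₂ (colExists K i (suc c) 1≤i i≤ℓ (s≤s z≤n) c<n)))
      ... | no  c≮n = contradiction c<n c≮n
      out′ : ∀ {c} → part a i ≤ c → f c ≡ 0
      out′ {c} n≤c with suc c ≤? part a i
      ... | yes c<n = contradiction n≤c (<⇒≱ c<n)
      ... | no  _   = refl
      desc : ∀ {c d} → c ≤ d → f d ≤ f c
      desc {c} {d} c≤d with f d in fd | f c in fc | m≤n⇒m<n∨m≡n c≤d
      ... | zero  | _     | _         = z≤n
      ... | suc r | suc s | inj₁ c<d  =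
        descend K i (suc s) (suc c) (suc r) (suc d) (path-cell 1≤i i≤ℓ fc) (path-cell 1≤i i≤ℓ fd) (s≤s c<d)
      -- A cell in the later column d places d, hence also c, within the length of the path, so f c
      -- cannot be 0.
      ... | suc r | zero  | inj₁ c<d  =
        contradiction fc (>⇒≢ (in′ (≤-trans (s≤s c≤d) (colRange K i (suc d) (suc r) (path-cell 1≤i i≤ℓ fd)))))
      ... | suc r | s     | inj₂ refl = ≤-reflexive (trans (sym fd) fc)
      bound : ∀ c → f c ≤ i
      bound c with f c in fc
      ... | zero  = z≤n
      ... | suc r = rowBound K (suc r) (suc c) i (path-cell 1≤i i≤ℓ fc)

    f g : ℕ → ℕ
    f = path p 1≤p p≤ℓ
    g = path q 1≤q q≤ℓ

    encodes : Encodes T f g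
    encodes = mk⇔ to from
      where
      from : ∀ {r c i} → Entry f g r c i → T r c ≡ just i
      from (low h) = path-cell 1≤p p≤ℓ h
      from (upp h) = path-cell 1≤q q≤ℓ h
      to : ∀ {r c i} → T r c ≡ just i → Entry f g r c i
      to {zero}  {c}     {i} e = contradiction (proj₁ (support K _ _ _ e)) λ ()
      to {suc r} {zero}  {i} e = contradiction (proj₁ (proj₂ (support K _ _ _ e))) λ ()
      to {suc r} {suc c} {i} e with i ≟ p | i ≟ q
      ... | yes refl | _        = low (cell-path 1≤p p≤ℓ e)
      ... | no _     | yes refl = upp (cell-path 1≤q q≤ℓ e)
      ... | no i≢p   | no i≢q   =
        contradiction (subst (suc c ≤_) (other i i≢p i≢q) (colRange K i _ _ e)) λ ()

    paths : IsQuasiYamanouchi T → Paths p q x y f g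
    paths qy = record
      { lower = isPath 1≤p p≤ℓ at-p ; upper = isPath 1≤q q≤ℓ at-q
      ; disjoint = disj ; crossing = cross ; supported = supp }
      where
      module E {r c i} = Equivalence (encodes {r} {c} {i})
      disj : ∀ c → 0 < f c → f c ≢ g c
      disj c 0<fc fc≡gc with f c in fc
      ... | suc r = <-irrefl (just-injective (trans (sym (E.from (low fc))) (E.from (upp (sym fc≡gc))))) p<q
      cross : ∀ c → 0 < g c → g c < f c → g c < f (suc c)
      cross c 0<gc gc<fc with g c in gc | f c in fc
      ... | suc s | suc r with inversion K p q (suc c) (suc r) (suc s) (E.from (low fc)) (E.from (upp gc)) p<q gc<fc
      ...   | t , s<t , e = subst (suc s <_) (sym (Entry-p (E.to e))) s<t
      at : ∀ {r c} → At f g (suc r) c → IsCell T (suc r) (suc c)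
      at (inj₁ h) = p , E.from (low h)
      at (inj₂ h) = q , E.from (upp h)
      ta : ∀ {r c} → IsCell T r (suc c) → At f g r c
      ta (i , e) with E.to e
      ... | low h = inj₁ h
      ... | upp h = inj₂ h
      supp : ∀ r → 0 < r → Occupied f g r →
             (r ≡ p × ∃[ c ] f c ≡ p) ⊎ (r ≡ q × ∃[ c ] g c ≡ q) ⊎
             (∃[ c ] ∃[ d ] (c ≤ d × At f g r c × At f g (suc r) d))
      supp (suc r) _ (c , h) with qy (suc r) (suc c , at h)
      ... | inj₁ (d , e) = own refl (E.to e)
        where
        own : ∀ {r d i} → r ≡ i → Entry f g r d i →
              (r ≡ p × ∃[ c ] f c ≡ p) ⊎ (r ≡ q × ∃[ c ] g c ≡ q) ⊎
              (∃[ c ] ∃[ d ] (c ≤ d × At f g r c × At f g (suc r) d))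
        own e (low h) = inj₁ (e , _ , trans h e)
        own e (upp h) = inj₂ (inj₁ (e , _ , trans h e))
      ... | inj₂ (zero  , _     , (_ , e) , _ , _)         = contradiction (E.to e) λ ()
      ... | inj₂ (suc _ , zero  , _ , (_ , e) , _)         = contradiction (E.to e) λ ()
      ... | inj₂ (suc c , suc d , e , e′ , s≤s c≤d)        = inj₂ (inj₂ (c , d , c≤d , ta e , ta e′))

  module Writing {f g : ℕ → ℕ} (P : Paths p q x y f g) where
    open Paths P
    private
      module L = Path lower
      module U = Path upper

    fill : Filling
    fill zero    _       = nothing
    fill (suc r) zero    = nothing
    fill (suc r) (suc c) with f c ≟ suc r | g c ≟ suc r
    ... | yes _ | _     = just p
    ... | no _  | yes _ = just q
    ... | no _  | no _  = nothing

    encodes : Encodes fill f g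
    encodes = mk⇔ to from
      where
      to : ∀ {r c i} → fill r c ≡ just i → Entry f g r c i
      to {suc r} {suc c} e with f c ≟ suc r | g c ≟ suc r
      to {suc r} {suc c} refl | yes h | _     = low h
      to {suc r} {suc c} refl | no _  | yes h = upp h
      from : ∀ {r c i} → Entry f g r c i → fill r c ≡ just i
      from {suc r} {suc c} (low h) with f c ≟ suc r
      ... | yes _ = refl
      ... | no ¬h = contradiction h ¬h
      from {suc r} {suc c} (upp h) with f c ≟ suc r | g c ≟ suc r
      ... | yes h′ | _     = contradiction (trans h′ (sym h)) (disjoint c (subst (0 <_) (sym h′) (s≤s z≤n)))
      ... | no _   | yes _ = refl
      ... | no _   | no ¬h = contradiction h ¬h

    private module E {r c i} = Equivalence (encodes {r} {c} {i})

    isQKT : IsQKT a fill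
    isQKT = record
      { support   = λ r c i e → supp (E.to {r} {c} e)
      ; colExists = exists
      ; colUnique = λ i c r r′ e e′ → unique (E.to {r} {c} e) (E.to {r′} {c} e′) refl
      ; colRange  = λ i c r e → range (E.to {r} {c} e)
      ; rowBound  = λ r c i e → bound (E.to {r} {c} e)
      ; descend   = λ i r c r′ c′ e e′ c<c′ → desc (E.to {r} {c} e) (E.to {r′} {c′} e′) refl c<c′
      ; inversion = λ i j c r r′ e e′ i<j r′<r → inv (E.to {r} {c} e) (E.to {r′} {c} e′) i<j r′<r
      } , qy
      where
      supp : ∀ {r c i} → Entry f g r c i → 1 ≤ r × 1 ≤ c × 1 ≤ i × i ≤ length a
      supp (low _) = s≤s z≤n , s≤s z≤n , 1≤p , p≤ℓ
      supp (upp _) = s≤s z≤n , s≤s z≤n , 1≤q , q≤ℓ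
      exists : ∀ i c → 1 ≤ i → i ≤ length a → 1 ≤ c → c ≤ part a i → ∃[ r ] fill r c ≡ just i
      exists i (suc c) _ _ _ c<n with i ≟ p | i ≟ q
      ... | yes refl | _        with f c in h | L.inside (subst (suc c ≤_) at-p c<n)
      ...   | suc r | _ = suc r , E.from (low h)
      exists i (suc c) _ _ _ c<n | no _ | yes refl with g c in h | U.inside (subst (suc c ≤_) at-q c<n)
      ...   | suc r | _ = suc r , E.from (upp h)
      exists i (suc c) _ _ _ c<n | no i≢p | no i≢q =
        contradiction (subst (suc c ≤_) (other i i≢p i≢q) c<n) λ ()
      unique : ∀ {i j c r r′} → Entry f g r c i → Entry f g r′ c j → i ≡ j → r ≡ r′
      unique (low h) (low h′) _ = trans (sym h) h′
      unique (upp h) (upp h′) _ = trans (sym h) h′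
      unique (low h) (upp h′) e = ⊥-elim (<-irrefl e p<q)
      unique (upp h) (low h′) e = ⊥-elim (<-irrefl (sym e) p<q)
      0<r : ∀ {v r} → v ≡ suc r → 0 < v
      0<r refl = s≤s z≤n
      range : ∀ {i c r} → Entry f g r c i → c ≤ part a i
      range (low h) = subst (_ ≤_) (sym at-p) (L.inside⁻¹ (0<r h))
      range (upp h) = subst (_ ≤_) (sym at-q) (U.inside⁻¹ (0<r h))
      bound : ∀ {i c r} → Entry f g r c i → r ≤ i
      bound (low h) = subst (_≤ p) h (L.bounded _)
      bound (upp h) = subst (_≤ q) h (U.bounded _)
      desc : ∀ {i j c c′ r r′} → Entry f g r c i → Entry f g r′ c′ j → i ≡ j → c < c′ → r′ ≤ r
      desc (low h) (low h′) _ (s≤s c<c′) = subst₂ _≤_ h′ h (L.descent (<⇒≤ c<c′))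
      desc (upp h) (upp h′) _ (s≤s c<c′) = subst₂ _≤_ h′ h (U.descent (<⇒≤ c<c′))
      desc (low h) (upp h′) e _ = ⊥-elim (<-irrefl e p<q)
      desc (upp h) (low h′) e _ = ⊥-elim (<-irrefl (sym e) p<q)
      inv : ∀ {i j c r r′} → Entry f g r c i → Entry f g r′ c j → i < j → r′ < r →
            ∃[ r″ ] (r′ < r″ × fill r″ (suc c) ≡ just i)
      inv (low _) (low _) i<j _ = ⊥-elim (<-irrefl refl i<j)
      inv (upp _) (upp _) i<j _ = ⊥-elim (<-irrefl refl i<j)
      inv (upp _) (low _) i<j _ = ⊥-elim (<-asym i<j p<q)
      inv {c = suc c} (low h) (upp h′) _ r′<r
        with f (suc c) in h″ | crossing c (0<r h′) (subst₂ _<_ (sym h′) (sym h) r′<r)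
      ... | suc t | gc<t = suc t , subst (_< suc t) h′ gc<t , E.from (low h″)
      at : ∀ {r c} → At f g (suc r) c → IsCell fill (suc r) (suc c)
      at (inj₁ h) = p , E.from (low h)
      at (inj₂ h) = q , E.from (upp h)
      occ : ∀ {r c i} → Entry f g r c i → Occupied f g r
      occ (low h) = _ , inj₁ h
      occ (upp h) = _ , inj₂ h
      own : ∀ {s} (h : ℕ → ℕ) → (∀ {r c} → h c ≡ suc r → fill (suc r) (suc c) ≡ just s) →
            1 ≤ s → ∃[ c ] h c ≡ s → ∃[ c ] fill s c ≡ just s
      own {suc s} h w _ (c , e) = suc c , w e
      qy : IsQuasiYamanouchi fill
      qy zero (_ , _ , ())
      qy (suc r) (c , i , e) with supported (suc r) (s≤s z≤n) (occ (E.to {suc r} {c} e))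
      ... | inj₁ (refl , o)        = inj₁ (own f (λ h → E.from (low h)) 1≤p o)
      ... | inj₂ (inj₁ (refl , o)) = inj₁ (own g (λ h → E.from (upp h)) 1≤q o)
      ... | inj₂ (inj₂ (c , d , c≤d , h , h′)) = inj₂ (suc c , suc d , at {r} {c} h , at {suc r} {d} h′ , s≤s c≤d)

-- Weights

indicator : ℕ → ℕ → ℕ
indicator v r with v ≟ r
... | yes _ = 1
... | no  _ = 0

indicator-≡ : ∀ {v r} → v ≡ r → indicator v r ≡ 1
indicator-≡ {v} {r} e with v ≟ r
... | yes _ = refl
... | no ¬e = contradiction e ¬e

indicator-≢ : ∀ {v r} → v ≢ r → indicator v r ≡ 0
indicator-≢ {v} {r} ne with v ≟ r
... | yes e = contradiction e ne
... | no _  = refl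

count : (ℕ → ℕ) → ℕ → ℕ → ℕ
count f zero    r = 0
count f (suc n) r = indicator (f 0) r + count (f ∘ suc) n r

count≡0 : ∀ f n {r} → (∀ c → f c ≢ r) → count f n r ≡ 0
count≡0 f zero    _  = refl
count≡0 f (suc n) ne = cong₂ _+_ (indicator-≢ (ne 0)) (count≡0 (f ∘ suc) n (ne ∘ suc))

weight : (f g : ℕ → ℕ) → ℕ → ℕ → ℕ
weight f g n r = count f n r + count g n r

-- Row 0 is left out: there `count` would see columns past the ends of the paths, not cells.
SameWeight : ℕ → (f g f′ g′ : ℕ → ℕ) → Set
SameWeight n f g f′ g′ = ∀ r → 0 < r → weight f g n r ≡ weight f′ g′ n r

Determined : (p q x y : ℕ) → Set
Determined p q x y = ∀ {f g f′ g′} → Paths p q x y f g → Paths p q x y f′ g′ →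
  SameWeight (x + y) f g f′ g′ → (∀ c → f c ≡ f′ c) × (∀ c → g c ≡ g′ c)

-- `upTo` is `applyUpTo id`, and its recursion replaces k by k ∘ suc, so the induction needs an
-- arbitrary k.
sum-columns : ∀ {f g r} (h : ℕ → ℕ) k n →
  (∀ c → h (suc (k c)) ≡ indicator (f (k c)) r + indicator (g (k c)) r) →
  sum (map h (map suc (applyUpTo k n))) ≡ weight (f ∘ k) (g ∘ k) n r
sum-columns {f} {g} h k zero    e = refl
sum-columns {f} {g} {r} h k (suc n) e =
  trans (cong₂ _+_ (e 0) (sum-columns {f} {g} h (k ∘ suc) n (e ∘ suc)))
        (interchange (indicator (f (k 0)) r) (indicator (g (k 0)) r) (count (f ∘ k ∘ suc) n r) (count (g ∘ k ∘ suc) n r))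

map-rows-injective : ∀ {φ ψ : ℕ → ℕ} k n →
  map φ (map suc (applyUpTo k n)) ≡ map ψ (map suc (applyUpTo k n)) →
  ∀ {i} → i < n → φ (suc (k i)) ≡ ψ (suc (k i))
map-rows-injective k (suc n) e {zero}  _         = proj₁ (∷-injective e)
map-rows-injective k (suc n) e {suc i} (s≤s i<n) = map-rows-injective (k ∘ suc) n (proj₂ (∷-injective e)) i<n

map-rows-cong : ∀ {φ ψ : ℕ → ℕ} → (∀ r → φ (suc r) ≡ ψ (suc r)) → ∀ rs → map φ (map suc rs) ≡ map ψ (map suc rs)
map-rows-cong e rs = trans (sym (map-∘ rs)) (trans (map-cong e rs) (map-∘ rs))

module MultiplicityFreeness (a : WeakComposition) (p q x y : ℕ) (parts : TwoParts a p q x y) where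
  open TwoParts parts
  open Tableaux a p q x y parts

  rowCount≡weight : ∀ {T f g} → Paths p q x y f g → Encodes T f g →
                    ∀ r → rowCount a T (suc r) ≡ weight f g (x + y) (suc r)
  rowCount≡weight {T} {f} {g} P enc r =
    trans (cong (λ n → sum (map h (map suc (upTo n)))) total) (sum-columns {f} {g} h id (x + y) cell)
    where
    open Paths P
    h : ℕ → ℕ
    h c = if is-just (T (suc r) c) then 1 else 0
    cell : ∀ c → h (suc c) ≡ indicator (f c) (suc r) + indicator (g c) (suc r)
    cell c with T (suc r) (suc c) in eq
    ... | nothing = sym (cong₂ _+_
          (indicator-≢ λ e → contradiction (trans (sym eq) (Equivalence.from enc (low e))) λ ())
          (indicator-≢ λ e → contradiction (trans (sym eq) (Equivalence.from enc (upp e))) λ ()))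
    ... | just i with Equivalence.to enc eq
    ...   | low e = sym (cong₂ _+_ (indicator-≡ e)
            (indicator-≢ λ e′ → disjoint c (subst (0 <_) (sym e) (s≤s z≤n)) (trans e (sym e′))))
    ...   | upp e = sym (cong₂ _+_
            (indicator-≢ λ e′ → disjoint c (subst (0 <_) (sym e′) (s≤s z≤n)) (trans e′ (sym e))) (indicator-≡ e))

  -- `wt` lists only rows up to `length a`, whereas `SameWeight` speaks of all positive rows. The
  -- missing rows lie above q, and no entry lies above the row of its own value.
  weight-above : ∀ {f g} → Paths p q x y f g → ∀ {r} → q < r → ∀ n → weight f g n r ≡ 0
  weight-above {f} {g} P q<r n = cong₂ _+_
    (count≡0 f n λ c e → <⇒≱ (<-trans p<q q<r) (subst (_≤ p) e (Path.bounded (Paths.lower P) c)))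
    (count≡0 g n λ c e → <⇒≱ q<r (subst (_≤ q) e (Path.bounded (Paths.upper P) c)))

  multiplicityFree⇔determined : MultiplicityFree a ⇔ Determined p q x y
  multiplicityFree⇔determined = mk⇔ to from
    where
    to : MultiplicityFree a → Determined p q x y
    to mf {f} {g} {f′} {g′} P P′ sw =
      (λ c → same (f c) (f′ c) (λ e → Entry-p (transfer (low e))) (λ e → Entry-p (transfer′ (low e)))) ,
      (λ c → same (g c) (g′ c) (λ e → Entry-q (transfer (upp e))) (λ e → Entry-q (transfer′ (upp e))))
      where
      module W  = Writing P
      module W′ = Writing P′
      T≡T′ : ∀ r c → W.fill r c ≡ W′.fill r c
      T≡T′ = mf W.fill W′.fill W.isQKT W′.isQKT
        (map-rows-cong (λ r → trans (rowCount≡weight P W.encodes r)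
          (trans (sw (suc r) (s≤s z≤n)) (sym (rowCount≡weight P′ W′.encodes r)))) (upTo (length a)))
      transfer : ∀ {r c i} → Entry f g r c i → Entry f′ g′ r c i
      transfer {r} {c} e = Equivalence.to (W′.encodes {r} {c})
        (trans (sym (T≡T′ r c)) (Equivalence.from W.encodes e))
      transfer′ : ∀ {r c i} → Entry f′ g′ r c i → Entry f g r c i
      transfer′ {r} {c} e = Equivalence.to (W.encodes {r} {c})
        (trans (T≡T′ r c) (Equivalence.from W′.encodes e))
      same : ∀ u v → (∀ {r} → u ≡ suc r → v ≡ suc r) → (∀ {r} → v ≡ suc r → u ≡ suc r) → u ≡ v
      same zero    zero    _ _ = refl
      same (suc u) v       h _ = sym (h refl)
      same zero    (suc v) _ h = h refl
    from : Determined p q x y → MultiplicityFree a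
    from det T T′ (K , qy) (K′ , qy′) wt≡ r c = same (T r c) (T′ r c)
        (λ e → Equivalence.from R′.encodes (carry f≡ g≡ (Equivalence.to (R.encodes {r} {c}) e)))
        (λ e → Equivalence.from R.encodes (carry (sym ∘ f≡) (sym ∘ g≡) (Equivalence.to (R′.encodes {r} {c}) e)))
      where
      module R  = Reading K
      module R′ = Reading K′
      P  = R.paths qy
      P′ = R′.paths qy′
      sw : SameWeight (x + y) R.f R.g R′.f R′.g
      sw (suc r) _ with suc r ≤? q
      ... | yes r<q = trans (sym (rowCount≡weight P R.encodes r))
            (trans (map-rows-injective id (length a) wt≡ (≤-trans r<q q≤ℓ)) (rowCount≡weight P′ R′.encodes r))
      ... | no r≮q  = trans (weight-above P (≰⇒> r≮q) (x + y)) (sym (weight-above P′ (≰⇒> r≮q) (x + y)))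
      f≡ = proj₁ (det P P′ sw)
      g≡ = proj₂ (det P P′ sw)
      carry : ∀ {f g f′ g′ : ℕ → ℕ} {r c i} → (∀ c → f c ≡ f′ c) → (∀ c → g c ≡ g′ c) →
              Entry f g r c i → Entry f′ g′ r c i
      carry h _ (low e) = low (trans (sym (h _)) e)
      carry _ h (upp e) = upp (trans (sym (h _)) e)
      same : (s t : Maybe ℕ) → (∀ {i} → s ≡ just i → t ≡ just i) → (∀ {i} → t ≡ just i → s ≡ just i) → s ≡ t
      same (just _) _        h _ = sym (h refl)
      same nothing  (just _) _ h = h refl
      same nothing  nothing  _ _ = refl

-- Tableaux given by lists of codes

infixl 9 _!?_
_!?_ : List ℕ → ℕ → Maybe ℕ
[]      !? _     = nothing
(s ∷ _) !? zero  = just s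
(_ ∷ F) !? suc c = F !? c

-- The right-hand side of `crossing`: the list is the tail of the lower path, and an empty tail
-- fails because that path has ended.
Below : List ℕ → ℕ → Set
Below []      _ = ⊥
Below (u ∷ _) v = u < v

-- Codes reverse the order of rows, so u < v means that the upper path is below the lower one.
-- Columns where one path has ended carry no constraint.
Compatible : List ℕ → List ℕ → Set
Compatible (u ∷ F) (v ∷ G) = u ≢ v × (u < v → Below F v) × Compatible F G
Compatible _       _       = ⊤

below? : ∀ F v → Dec (Below F v)
below? []      _ = no λ ()
below? (u ∷ _) v = u <? v

compatible? : ∀ F G → Dec (Compatible F G)
compatible? []      _       = yes tt
compatible? (_ ∷ _) []      = yes tt
compatible? (u ∷ F) (v ∷ G) = ¬? (u ≟ v) ×-dec ((u <? v) →-dec below? F v) ×-dec compatible? F G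

Supported : List ℕ → List ℕ → ℕ → Set
Supported F G s = ∃[ c ] ∃[ d ] (c ≤ d ×
  (F !? c ≡ just (suc s) × G !? d ≡ just s ⊎ G !? c ≡ just (suc s) × F !? d ≡ just s))

-- `supported` is indexed by the code s of the supporting row; the supported row has code `suc s`.
-- Code 1 is row p, justified by `starts`; F never has code 0, as q exceeds its bound p.
record Coded (B : ℕ) (F G : List ℕ) : Set where
  field
    sortedF    : Linked _≤_ F
    sortedG    : Linked _≤_ G
    boundedF   : All (λ s → 1 ≤ s × s ≤ B) F
    boundedG   : All (_≤ B) G
    starts     : F !? 0 ≡ just 1
    compatible : Compatible F G
    supported  : ∀ {s} → 1 ≤ s → s < B → Supported F G s

!?-All : ∀ {P : ℕ → Set} {F} → All P F → ∀ c {s} → F !? c ≡ just s → P s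
!?-All (p ∷ _)  zero    refl = p
!?-All (_ ∷ ps) (suc c) e    = !?-All ps c e

module Rows (p q : ℕ) (p<q : p < q) where

  -- Code 0 stands for row q, and code suc d for the row at depth d below row p.
  row : ℕ → ℕ
  row zero    = q
  row (suc d) = p ∸ d

  -- The bound s ≤ p keeps the subtraction from truncating to 0, the value that marks an ended path.
  row-positive : ∀ {s} → s ≤ p → 0 < row s
  row-positive {zero}  _   = ≤-trans (s≤s z≤n) p<q
  row-positive {suc d} d<p = m<n⇒0<n∸m d<p

  row-≤p : ∀ {s} → 1 ≤ s → row s ≤ p
  row-≤p {suc d} _ = m∸n≤m p d

  row-≤q : ∀ s → row s ≤ q
  row-≤q zero    = ≤-refl
  row-≤q (suc d) = ≤-trans (m∸n≤m p d) (<⇒≤ p<q)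

  row-antitone : ∀ {s t} → s ≤ t → row t ≤ row s
  row-antitone {zero}  {t}     _         = row-≤q t
  row-antitone {suc d} {suc e} (s≤s d≤e) = ∸-monoʳ-≤ p d≤e

  row-strict : ∀ {s t} → t ≤ p → s < t → row t < row s
  row-strict {zero}  {suc e} _   _         = ≤-<-trans (m∸n≤m p e) p<q
  row-strict {suc d} {suc e} e<p (s≤s d<e) = ∸-monoʳ-< d<e (<⇒≤ e<p)

  row-strict⁻¹ : ∀ {s t} → row t < row s → s < t
  row-strict⁻¹ {s} {t} lt with t ≤? s
  ... | yes t≤s = contradiction (row-antitone t≤s) (<⇒≱ lt)
  ... | no  t≰s = ≰⇒> t≰s

  row-injective : ∀ {s t} → s ≤ p → t ≤ p → row s ≡ row t → s ≡ t
  row-injective {s} {t} s≤p t≤p e with <-cmp s t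
  ... | tri< s<t _ _ = contradiction (sym e) (<⇒≢ (row-strict t≤p s<t))
  ... | tri≈ _ s≡t _ = s≡t
  ... | tri> _ _ t<s = contradiction e (<⇒≢ (row-strict s≤p t<s))

  row-suc : ∀ {d} → suc d ≤ p → row (suc d) ≡ suc (row (suc (suc d)))
  -- `suc p ∸ suc d` computes to `p ∸ d`, which makes this an instance of associativity.
  row-suc d<p = +-∸-assoc 1 d<p

  walk : List ℕ → ℕ → ℕ
  walk []      _       = 0
  walk (s ∷ F) zero    = row s
  walk (s ∷ F) (suc c) = walk F c

  walk-!? : ∀ F c {s} → F !? c ≡ just s → walk F c ≡ row s
  walk-!? (s ∷ F) zero    refl = refl
  walk-!? (s ∷ F) (suc c) e    = walk-!? F c e

  !?-walk : ∀ F c → 0 < walk F c → ∃[ s ] F !? c ≡ just s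
  !?-walk (s ∷ F) zero    _ = s , refl
  !?-walk (s ∷ F) (suc c) h = !?-walk F c h

  walk-path : ∀ {top F} → Linked _≤_ F → All (λ s → s ≤ p × row s ≤ top) F → Path top (length F) (walk F)
  walk-path {top} {F} srt bnd = record
    { inside = inside F bnd ; outside = outside F ; descent = descent F srt ; bounded = bounded F bnd }
    where
    inside : ∀ F → All (λ s → s ≤ p × row s ≤ top) F → ∀ {c} → c < length F → 0 < walk F c
    inside (s ∷ F) ((h , _) ∷ _) {zero}  _         = row-positive h
    inside (s ∷ F) (_ ∷ hs)      {suc c} (s≤s c<n) = inside F hs c<n
    outside : ∀ F {c} → length F ≤ c → walk F c ≡ 0
    outside []      _         = refl
    outside (s ∷ F) (s≤s n≤c) = outside F n≤c
    bounded : ∀ F → All (λ s → s ≤ p × row s ≤ top) F → ∀ c → walk F c ≤ top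
    bounded []      _             _       = z≤n
    bounded (s ∷ F) ((_ , h) ∷ _) zero    = h
    bounded (s ∷ F) (_ ∷ hs)      (suc c) = bounded F hs c
    tail : ∀ {s F} → Linked _≤_ (s ∷ F) → Linked _≤_ F
    tail [-]     = []
    tail (_ ∷ l) = l
    first : ∀ {s} F → Linked _≤_ (s ∷ F) → ∀ d → walk F d ≤ row s
    first []      _        _       = z≤n
    first (t ∷ F) (st ∷ _) zero    = row-antitone st
    first (t ∷ F) (st ∷ l) (suc d) = ≤-trans (first F l d) (row-antitone st)
    descent : ∀ F → Linked _≤_ F → ∀ {c d} → c ≤ d → walk F d ≤ walk F c
    descent []      _ _                        = z≤n
    descent (s ∷ F) l {zero}  {zero}  _         = ≤-refl
    descent (s ∷ F) l {zero}  {suc d} _         = first F l d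
    descent (s ∷ F) l {suc c} {suc d} (s≤s c≤d) = descent F (tail l) c≤d

  Coded⇒Paths : ∀ {B F G} → B ≤ p → Coded B F G → Paths p q (length F) (length G) (walk F) (walk G)
  Coded⇒Paths {B} {F} {G} B≤p C = record
    { lower     = walk-path sortedF (All.map (λ (1≤s , s≤B) → ≤-trans s≤B B≤p , row-≤p 1≤s) boundedF)
    ; upper     = walk-path sortedG (All.map (λ {s} s≤B → ≤-trans s≤B B≤p , row-≤q s) boundedG)
    ; disjoint  = disjoint F G (All.map proj₂ boundedF) boundedG compatible
    ; crossing  = crossing F G boundedG compatible
    ; supported = rows
    }
    where
    open Coded C
    disjoint : ∀ F G → All (_≤ B) F → All (_≤ B) G → Compatible F G → ∀ c → 0 < walk F c → walk F c ≢ walk G c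
    disjoint (u ∷ F) []      _        _        _             _       0<f e = >⇒≢ 0<f e
    disjoint (u ∷ F) (v ∷ G) (h ∷ _)  (h′ ∷ _) (u≢v , _)     zero    _   e =
      u≢v (row-injective (≤-trans h B≤p) (≤-trans h′ B≤p) e)
    disjoint (u ∷ F) (v ∷ G) (_ ∷ hs) (_ ∷ hs′) (_ , _ , rest) (suc c) 0<f e =
      disjoint F G hs hs′ rest c 0<f e
    crossing : ∀ F G → All (_≤ B) G → Compatible F G → ∀ c →
               0 < walk G c → walk G c < walk F c → walk G c < walk F (suc c)
    crossing (u ∷ [])     (v ∷ G) _        (_ , b , _) zero    _   lt = ⊥-elim (b (row-strict⁻¹ lt))
    crossing (u ∷ u′ ∷ F) (v ∷ G) (h ∷ _)  (_ , b , _) zero    _   lt =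
      row-strict (≤-trans h B≤p) (b (row-strict⁻¹ lt))
    crossing (u ∷ F)      (v ∷ G) (_ ∷ hs) (_ , _ , r) (suc c) 0<g lt = crossing F G hs r c 0<g lt
    Support : ℕ → Set
    Support r = (r ≡ p × ∃[ c ] walk F c ≡ p) ⊎ (r ≡ q × ∃[ c ] walk G c ≡ q) ⊎
                (∃[ c ] ∃[ d ] (c ≤ d × At (walk F) (walk G) r c × At (walk F) (walk G) (suc r) d))
    code : ∀ s → 1 ≤ s → s ≤ B → Support (row s)
    code (suc zero)    _ _   = inj₁ (refl , 0 , walk-!? F 0 starts)
    code (suc (suc s)) _ s<B with supported (s≤s z≤n) s<B
    ... | c , d , c≤d , inj₁ (h , h′) = inj₂ (inj₂ (c , d , c≤d , inj₁ (walk-!? F c h) ,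
            inj₂ (trans (walk-!? G d h′) (row-suc (≤-trans (<⇒≤ s<B) B≤p)))))
    ... | c , d , c≤d , inj₂ (h , h′) = inj₂ (inj₂ (c , d , c≤d , inj₂ (walk-!? G c h) ,
            inj₁ (trans (walk-!? F d h′) (row-suc (≤-trans (<⇒≤ s<B) B≤p)))))
    rows : ∀ r → 0 < r → Occupied (walk F) (walk G) r → Support r
    rows r 0<r (c , inj₁ refl) with !?-walk F c 0<r
    ... | s , e = subst Support (sym (walk-!? F c e)) (code s (proj₁ (!?-All boundedF c e)) (proj₂ (!?-All boundedF c e)))
    rows r 0<r (c , inj₂ refl) with !?-walk G c 0<r
    ... | zero  , e = inj₂ (inj₁ (walk-!? G c e , c , walk-!? G c e))
    ... | suc s , e = subst Support (sym (walk-!? G c e)) (code (suc s) (s≤s z≤n) (!?-All boundedG c e))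

  total : ℕ → List ℕ → ℕ
  total r F = sum (map (λ s → indicator (row s) r) F)

  count-walk : ∀ F {n r} → 0 < r → length F ≤ n → count (walk F) n r ≡ total r F
  count-walk []      {n}     0<r _         = count≡0 (walk []) n (λ _ → <⇒≢ 0<r)
  count-walk (s ∷ F) {suc n} 0<r (s≤s len) = cong (indicator (row s) _ +_) (count-walk F 0<r len)

  total-++ : ∀ r F G → total r (F ++ G) ≡ total r F + total r G
  total-++ r F G = trans (cong sum (map-++ _ F G)) (sum-++ (map _ F) (map _ G))

  -- Two coded pairs with equal row totals give tableaux of equal weight, and different codes in one
  -- column c give different rows because `row` is injective on codes up to p.
  undetermined : ∀ {B B′ F G F′ G′ x y} → B ≤ p → Coded B F G → B′ ≤ p → Coded B′ F′ G′ →
    length F ≡ x → length F′ ≡ x → length G ≡ y → length G′ ≡ y →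
    (∀ r → total r F + total r G ≡ total r F′ + total r G′) →
    ∀ {c s t} → F !? c ≡ just s → F′ !? c ≡ just t → s ≢ t → ¬ Determined p q x y
  undetermined {F = F} {G} {F′} {G′} B≤p C B′≤p C′ refl ex refl ey tot {c} es et s≢t det =
    s≢t (row-injective (≤-trans (proj₂ (!?-All (Coded.boundedF C) c es)) B≤p)
                       (≤-trans (proj₂ (!?-All (Coded.boundedF C′) c et)) B′≤p)
                       (trans (sym (walk-!? F c es)) (trans (f≡ c) (walk-!? F′ c et))))
    where
    f≡ = proj₁ (det (Coded⇒Paths B≤p C)
      (subst₂ (λ x y → Paths p q x y (walk F′) (walk G′)) ex ey (Coded⇒Paths B′≤p C′))
      λ r 0<r → trans (cong₂ _+_ (count-walk F 0<r (m≤m+n _ _)) (count-walk G 0<r (m≤n+m _ (length F))))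
        (trans (tot r) (sym (cong₂ _+_
          (count-walk F′ 0<r (≤-trans (≤-reflexive ex) (m≤m+n _ _)))
          (count-walk G′ 0<r (≤-trans (≤-reflexive ey) (m≤n+m _ (length F))))))))

infixr 5 _^_▹_
_^_▹_ : ℕ → ℕ → List ℕ → List ℕ
u ^ m ▹ F = replicate m u ++ F

sorted-^ : ∀ {u F} m → Linked _≤_ (u ∷ F) → Linked _≤_ (u ^ m ▹ u ∷ F)
sorted-^ zero          l = l
sorted-^ (suc zero)    l = ≤-refl ∷ l
sorted-^ (suc (suc m)) l = ≤-refl ∷ sorted-^ (suc m) l

sorted-replicate : ∀ {u v} n → u ≤ v → Linked _≤_ (u ∷ replicate n v)
sorted-replicate zero    _   = [-]
sorted-replicate (suc n) u≤v = u≤v ∷ sorted-replicate n ≤-refl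

-- Inside the repeated block the next lower code is again u, so the crossing condition reads u < v →
-- u < v and `id` proves it.
compatible-^ : ∀ {u v F G} m → Compatible (u ∷ F) (v ∷ G) → Compatible (u ^ m ▹ u ∷ F) (v ^ m ▹ v ∷ G)
compatible-^ zero          h             = h
compatible-^ (suc zero)    h             = proj₁ h , id , h
compatible-^ (suc (suc m)) h             = proj₁ h , id , compatible-^ (suc m) h

!?-^ : ∀ u m F c → (u ^ m ▹ F) !? (m + c) ≡ F !? c
!?-^ u zero    F c = refl
!?-^ u (suc m) F c = !?-^ u m F c

supported-^ : ∀ {u v F G s} m → Supported F G s → Supported (u ^ m ▹ F) (v ^ m ▹ G) s
supported-^ {u} {v} {F} {G} m (c , d , c≤d , inj₁ (h , h′)) = m + c , m + d , +-monoʳ-≤ m c≤d ,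
  inj₁ (trans (!?-^ u m F c) h , trans (!?-^ v m G d) h′)
supported-^ {u} {v} {F} {G} m (c , d , c≤d , inj₂ (h , h′)) = m + c , m + d , +-monoʳ-≤ m c≤d ,
  inj₂ (trans (!?-^ v m G c) h , trans (!?-^ u m F d) h′)

coded-^ : ∀ {B v F G} m → Coded B (1 ∷ F) (v ∷ G) → Coded B (1 ^ m ▹ 1 ∷ F) (v ^ m ▹ v ∷ G)
coded-^ m C = record
  { sortedF    = sorted-^ m sortedF
  ; sortedG    = sorted-^ m sortedG
  ; boundedF   = ++⁺ (replicate⁺ m (All.head boundedF)) boundedF
  ; boundedG   = ++⁺ (replicate⁺ m (All.head boundedG)) boundedG
  ; starts     = begins m
  ; compatible = compatible-^ m compatible
  ; supported  = λ 1≤s s<B → supported-^ m (supported 1≤s s<B)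
  }
  where
  open Coded C
  begins : ∀ m {F} → (1 ^ m ▹ 1 ∷ F) !? 0 ≡ just 1
  begins zero    = refl
  begins (suc m) = refl

length-^ : ∀ u m F → length (u ^ m ▹ F) ≡ m + length F
length-^ u m F = trans (length-++ (replicate m u)) (cong (_+ length F) (length-replicate m))

-- Families of pairs of tableaux with equal weight

-- m counts the copies of the first column, n the prolongation of the longer path. The families
-- cover, in order, the differences x - y ≥ 2, y - x ≥ 1, 0 and x - y = 1, each from the first
-- length at which its pair exists.
data NonMultiplicityFree : ℕ → ℕ → Set where
  long-lower   : ∀ m n → NonMultiplicityFree (m + (5 + n)) (m + 3)
  long-upper   : ∀ m n → NonMultiplicityFree (m + 3) (m + (4 + n))
  same-length  : ∀ m   → NonMultiplicityFree (m + 5) (m + 5)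
  lower-by-one : ∀ m   → NonMultiplicityFree (m + 5) (m + 4)

bounds? : ∀ B F → Dec (All (λ s → 1 ≤ s × s ≤ B) F)
bounds? B = All.all? (λ s → (1 ≤? s) ×-dec (s ≤? B))

bound? : ∀ B G → Dec (All (_≤ B) G)
bound? B = All.all? (_≤? B)

sorted? : ∀ F → Dec (Linked _≤_ F)
sorted? = linked? _≤?_

below-2 : ∀ F G → Supported F G 1 → ∀ {s} → 1 ≤ s → s < 2 → Supported F G s
below-2 _ _ h {suc zero}    _ _                 = h
below-2 _ _ h {suc (suc _)} _ (s≤s (s≤s ()))

below-3 : ∀ F G → Supported F G 1 → Supported F G 2 → ∀ {s} → 1 ≤ s → s < 3 → Supported F G s
below-3 _ _ h h′ {suc zero}             _ _ = h
below-3 _ _ h h′ {suc (suc zero)}       _ _ = h′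
below-3 _ _ h h′ {suc (suc (suc _))}    _ (s≤s (s≤s (s≤s ())))

-- For concrete lists the decidable conditions are settled by evaluation through the implicit `True`
-- arguments; only the support witnesses are supplied.
closed : ∀ {B} F G {_ : True (sorted? F)} {_ : True (sorted? G)} {_ : True (bounds? B F)}
         {_ : True (bound? B G)} {_ : True (compatible? F G)} → F !? 0 ≡ just 1 →
         (∀ {s} → 1 ≤ s → s < B → Supported F G s) → Coded B F G
closed F G {sF} {sG} {bF} {bG} {c} st sup = record
  { sortedF = toWitness sF ; sortedG = toWitness sG ; boundedF = toWitness bF ; boundedG = toWitness bG
  ; starts = st ; compatible = toWitness c ; supported = sup }

-- In each of the following modules, F₁ , G₁ and F₂ , G₂ are the lower and upper paths of
-- two tableaux with the same weight; repeating their common first column m times gives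
-- the family.
module LongLower (n : ℕ) where
  F₁ F₂ G₁ G₂ : List ℕ
  -- The upper path runs under the lower one throughout, which constrains lower columns up to 3. The
  -- exchange of codes 2 and 3 happens in upper column 1 and in lower column 4, just beyond that
  -- reach; hence x ≥ y + 2.
  F₁ = 1 ∷ 1 ∷ 1 ∷ 2 ∷ 3 ∷ replicate n 3
  F₂ = 1 ∷ 1 ∷ 1 ∷ 2 ∷ 2 ∷ replicate n 3
  G₁ = 2 ∷ 2 ∷ 3 ∷ []
  G₂ = 2 ∷ 3 ∷ 3 ∷ []

  coded₁ : Coded 3 F₁ G₁
  coded₁ = record
    { sortedF  = ≤-refl ∷ ≤-refl ∷ n≤1+n 1 ∷ n≤1+n 2 ∷ sorted-replicate n ≤-refl
    ; sortedG  = from-yes (sorted? G₁)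
    ; boundedF = ++⁺ (from-yes (bounds? 3 (1 ∷ 1 ∷ 1 ∷ 2 ∷ 3 ∷ []))) (replicate⁺ n (s≤s z≤n , ≤-refl))
    ; boundedG = from-yes (bound? 3 G₁)
    ; starts   = refl
    ; compatible = from-yes (compatible? F₁ G₁)
    ; supported  = below-3 F₁ G₁ (0 , 0 , z≤n , inj₂ (refl , refl)) (2 , 3 , n≤1+n 2 , inj₂ (refl , refl))
    }

  coded₂ : Coded 3 F₂ G₂
  coded₂ = record
    { sortedF  = ≤-refl ∷ ≤-refl ∷ n≤1+n 1 ∷ ≤-refl ∷ sorted-replicate n (n≤1+n 2)
    ; sortedG  = from-yes (sorted? G₂)
    ; boundedF = ++⁺ (from-yes (bounds? 3 (1 ∷ 1 ∷ 1 ∷ 2 ∷ 2 ∷ []))) (replicate⁺ n (s≤s z≤n , ≤-refl))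
    ; boundedG = from-yes (bound? 3 G₂)
    ; starts   = refl
    ; compatible = from-yes (compatible? F₂ G₂)
    ; supported  = below-3 F₂ G₂ (0 , 0 , z≤n , inj₂ (refl , refl)) (1 , 3 , s≤s z≤n , inj₂ (refl , refl))
    }

module LongUpper (n : ℕ) where
  F₁ F₂ G₁ G₂ : List ℕ
  -- Codes 1 and 2 are exchanged between lower column 1 and upper column 3. The latter lies past the
  -- end of the lower path, so no lower cell interferes with it.
  F₁ = 1 ∷ 1 ∷ 2 ∷ []
  F₂ = 1 ∷ 2 ∷ 2 ∷ []
  G₁ = 0 ∷ 0 ∷ 1 ∷ 2 ∷ replicate n 2
  G₂ = 0 ∷ 0 ∷ 1 ∷ 1 ∷ replicate n 2

  coded₁ : Coded 2 F₁ G₁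
  coded₁ = record
    { sortedF  = from-yes (sorted? F₁)
    ; sortedG  = ≤-refl ∷ z≤n ∷ n≤1+n 1 ∷ sorted-replicate n ≤-refl
    ; boundedF = from-yes (bounds? 2 F₁)
    ; boundedG = ++⁺ (from-yes (bound? 2 (0 ∷ 0 ∷ 1 ∷ 2 ∷ []))) (replicate⁺ n ≤-refl)
    ; starts   = refl
    ; compatible = from-yes (compatible? F₁ G₁)
    ; supported  = below-2 F₁ G₁ (2 , 2 , ≤-refl , inj₁ (refl , refl))
    }

  coded₂ : Coded 2 F₂ G₂
  coded₂ = record
    { sortedF  = from-yes (sorted? F₂)
    ; sortedG  = ≤-refl ∷ z≤n ∷ ≤-refl ∷ sorted-replicate n (n≤1+n 1)
    ; boundedF = from-yes (bounds? 2 F₂)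
    ; boundedG = ++⁺ (from-yes (bound? 2 (0 ∷ 0 ∷ 1 ∷ 1 ∷ []))) (replicate⁺ n ≤-refl)
    ; starts   = refl
    ; compatible = from-yes (compatible? F₂ G₂)
    ; supported  = below-2 F₂ G₂ (1 , 2 , n≤1+n 1 , inj₁ (refl , refl))
    }


module SameLength where
  F₁ F₂ G₁ G₂ : List ℕ
  -- The exchange of `LongUpper`, but the lower path now continues under the exchanged upper cell
  -- and needs code 3 there. In the second tableau the code 2 supporting it survives in the upper
  -- path only in column 4, hence five columns.
  F₁ = 1 ∷ 1 ∷ 2 ∷ 3 ∷ 3 ∷ []
  F₂ = 1 ∷ 2 ∷ 2 ∷ 3 ∷ 3 ∷ []
  G₁ = 0 ∷ 0 ∷ 1 ∷ 2 ∷ 2 ∷ []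
  G₂ = 0 ∷ 0 ∷ 1 ∷ 1 ∷ 2 ∷ []

  coded₁ : Coded 3 F₁ G₁
  coded₁ = closed F₁ G₁ refl
    (below-3 F₁ G₁ (2 , 2 , ≤-refl , inj₁ (refl , refl)) (3 , 3 , ≤-refl , inj₁ (refl , refl)))

  coded₂ : Coded 3 F₂ G₂
  coded₂ = closed F₂ G₂ refl
    (below-3 F₂ G₂ (1 , 2 , n≤1+n 1 , inj₁ (refl , refl)) (3 , 4 , n≤1+n 3 , inj₁ (refl , refl)))

module LowerByOne where
  F₁ F₂ G₁ G₂ : List ℕ
  -- In the first tableau the upper path drops under the lower one after column 0; in the second it
  -- stays above. Both have 1, 3, 3 and 2 cells of codes 0, 1, 2 and 3.
  F₁ = 1 ∷ 1 ∷ 1 ∷ 2 ∷ 2 ∷ []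
  F₂ = 1 ∷ 2 ∷ 2 ∷ 3 ∷ 3 ∷ []
  G₁ = 0 ∷ 2 ∷ 3 ∷ 3 ∷ []
  G₂ = 0 ∷ 1 ∷ 1 ∷ 2 ∷ []

  coded₁ : Coded 3 F₁ G₁
  coded₁ = closed F₁ G₁ refl
    (below-3 F₁ G₁ (1 , 1 , ≤-refl , inj₂ (refl , refl)) (2 , 3 , n≤1+n 2 , inj₂ (refl , refl)))

  coded₂ : Coded 3 F₂ G₂
  coded₂ = closed F₂ G₂ refl
    (below-3 F₂ G₂ (1 , 1 , ≤-refl , inj₁ (refl , refl)) (3 , 3 , ≤-refl , inj₁ (refl , refl)))

module Undetermined (p q : ℕ) (p<q : p < q) (3≤p : 3 ≤ p) where
  open Rows p q p<q

  private
    2≤p = ≤-trans (n≤1+n 2) 3≤p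

    same-total : ∀ {F₁ F₂ G₁ G₂} u v m r → total r F₁ + total r G₁ ≡ total r F₂ + total r G₂ →
      total r (u ^ m ▹ F₁) + total r (v ^ m ▹ G₁) ≡ total r (u ^ m ▹ F₂) + total r (v ^ m ▹ G₂)
    same-total {F₁} {F₂} {G₁} {G₂} u v m r e = begin
      total r (u ^ m ▹ F₁) + total r (v ^ m ▹ G₁)  ≡⟨ cong₂ _+_ (total-++ r U F₁) (total-++ r V G₁) ⟩
      total r U + total r F₁ + (total r V + total r G₁)  ≡⟨ interchange (total r U) (total r F₁) (total r V) (total r G₁) ⟩
      total r U + total r V + (total r F₁ + total r G₁)  ≡⟨ cong (total r U + total r V +_) e ⟩
      total r U + total r V + (total r F₂ + total r G₂)  ≡⟨ interchange (total r U) (total r V) (total r F₂) (total r G₂) ⟩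
      total r U + total r F₂ + (total r V + total r G₂)  ≡⟨ cong₂ _+_ (total-++ r U F₂) (total-++ r V G₂) ⟨
      total r (u ^ m ▹ F₂) + total r (v ^ m ▹ G₂)  ∎
      where
      open ≡-Reasoning
      U = replicate m u
      V = replicate m v

  pumped : ∀ {B v F₁ F₂ G₁ G₂ x y} m → B ≤ p → Coded B (1 ∷ F₁) (v ∷ G₁) → Coded B (1 ∷ F₂) (v ∷ G₂) →
    length (1 ∷ F₁) ≡ x → length (1 ∷ F₂) ≡ x → length (v ∷ G₁) ≡ y → length (v ∷ G₂) ≡ y →
    (∀ r → total r (1 ∷ F₁) + total r (v ∷ G₁) ≡ total r (1 ∷ F₂) + total r (v ∷ G₂)) →
    ∀ c {s t} → (1 ∷ F₁) !? c ≡ just s → (1 ∷ F₂) !? c ≡ just t → s ≢ t →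
    ¬ Determined p q (m + x) (m + y)
  pumped {v = v} {F₁} {F₂} {G₁} {G₂} m B≤p C₁ C₂ ex₁ ex₂ ey₁ ey₂ tot c es et =
    undetermined B≤p (coded-^ m C₁) B≤p (coded-^ m C₂)
      (len ex₁) (len ex₂) (len ey₁) (len ey₂)
      (λ r → same-total {1 ∷ F₁} {1 ∷ F₂} {v ∷ G₁} {v ∷ G₂} 1 v m r (tot r))
      (trans (!?-^ 1 m (1 ∷ F₁) c) es) (trans (!?-^ 1 m (1 ∷ F₂) c) et)
    where
    len : ∀ {u F n} → length F ≡ n → length (u ^ m ▹ F) ≡ m + n
    len {u} {F} e = trans (length-^ u m F) (cong (m +_) e)

  nonMultiplicityFree⇒¬determined : ∀ {x y} → NonMultiplicityFree x y → ¬ Determined p q x y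
  nonMultiplicityFree⇒¬determined (long-lower m n) = pumped m 3≤p coded₁ coded₂
    (cong (5 +_) (length-replicate n)) (cong (5 +_) (length-replicate n)) refl refl
    (λ r → eq (ind r 1) (ind r 2) (ind r 3) (total r (replicate n 3))) 4 refl refl λ ()
    where
    open LongLower n
    ind = λ r s → indicator (row s) r
    -- i, j, k are the indicators of codes 1, 2, 3 at row r and t is the total of the prolonged end,
    -- so equality of weights becomes a linear identity.
    eq : ∀ i j k t → i + (i + (i + (j + (k + t)))) + (j + (j + (k + 0)))
                   ≡ i + (i + (i + (j + (j + t)))) + (j + (k + (k + 0)))
    eq = solve-∀
  nonMultiplicityFree⇒¬determined (long-upper m n) = pumped m 2≤p coded₁ coded₂
    refl refl (cong (4 +_) (length-replicate n)) (cong (4 +_) (length-replicate n))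
    (λ r → eq (ind r 0) (ind r 1) (ind r 2) (total r (replicate n 2))) 1 refl refl λ ()
    where
    open LongUpper n
    ind = λ r s → indicator (row s) r
    eq : ∀ h i j t → i + (i + (j + 0)) + (h + (h + (i + (j + t))))
                   ≡ i + (j + (j + 0)) + (h + (h + (i + (i + t))))
    eq = solve-∀
  nonMultiplicityFree⇒¬determined (same-length m) = pumped m 3≤p coded₁ coded₂ refl refl refl refl
    (λ r → eq (ind r 0) (ind r 1) (ind r 2) (ind r 3)) 1 refl refl λ ()
    where
    open SameLength
    ind = λ r s → indicator (row s) r
    eq : ∀ h i j k → i + (i + (j + (k + (k + 0)))) + (h + (h + (i + (j + (j + 0)))))
                   ≡ i + (j + (j + (k + (k + 0)))) + (h + (h + (i + (i + (j + 0)))))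
    eq = solve-∀
  nonMultiplicityFree⇒¬determined (lower-by-one m) = pumped m 3≤p coded₁ coded₂ refl refl refl refl
    (λ r → eq (ind r 0) (ind r 1) (ind r 2) (ind r 3)) 1 refl refl λ ()
    where
    open LowerByOne
    ind = λ r s → indicator (row s) r
    eq : ∀ h i j k → i + (i + (i + (j + (j + 0)))) + (h + (j + (k + (k + 0))))
                   ≡ i + (j + (j + (k + (k + 0)))) + (h + (i + (i + (j + 0))))
    eq = solve-∀

-- Paths of quasi-Yamanouchi tableaux

count-positive : ∀ f {n c r} → c < n → f c ≡ r → 0 < count f n r
count-positive f {suc n} {zero} {r} _         e = subst (λ i → 0 < i + count (f ∘ suc) n r) (sym (indicator-≡ e)) (s≤s z≤n)
count-positive f {suc n} {suc c} (s≤s c<n) e = ≤-trans (count-positive (f ∘ suc) c<n e) (m≤n+m _ _)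

count-witness : ∀ f n {r} → 0 < count f n r → ∃[ c ] f c ≡ r
count-witness f (suc n) {r} h with f 0 ≟ r
... | yes e = 0 , e
... | no  _ with count-witness (f ∘ suc) n h
...   | c , e = suc c , e

Antitone : (ℕ → ℕ) → Set
Antitone f = ∀ {c d} → c ≤ d → f d ≤ f c

antitone-suc : ∀ {f} → Antitone f → Antitone (f ∘ suc)
antitone-suc h c≤d = h (s≤s c≤d)

-- The first value is the largest one, so if positive it is the largest r with a nonzero count. Its
-- indicator cancels, and the tails are treated in the same way.
count-determines : ∀ {f f′} → Antitone f → Antitone f′ → ∀ n →
  (∀ r → 0 < r → count f n r ≡ count f′ n r) → ∀ {c} → c < n → f c ≡ f′ c
count-determines {f} {f′} h h′ (suc n) e = go
  where
  not-below : ∀ {f f′} → Antitone f → (∀ r → 0 < r → count f (suc n) r ≡ count f′ (suc n) r) → ¬ f 0 < f′ 0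
  not-below {f} {f′} h e lt = <⇒≢ (count-positive f′ (s≤s (z≤n {n})) refl)
    (trans (sym (count≡0 f (suc n) λ c e′ → <⇒≱ lt (subst (_≤ f 0) e′ (h z≤n)))) (e (f′ 0) (≤-<-trans z≤n lt)))
  first : f 0 ≡ f′ 0
  first = ≤-antisym (≮⇒≥ (not-below {f′} {f} h′ (λ r 0<r → sym (e r 0<r)))) (≮⇒≥ (not-below {f} {f′} h e))
  rest : ∀ r → 0 < r → count (f ∘ suc) n r ≡ count (f′ ∘ suc) n r
  rest r 0<r = +-cancelˡ-≡ (indicator (f 0) r) _ _
    (trans (e r 0<r) (cong (λ v → indicator v r + count (f′ ∘ suc) n r) (sym first)))
  go : ∀ {c} → c < suc n → f c ≡ f′ c
  go {zero}  _         = first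
  go {suc c} (s≤s c<n) = count-determines (antitone-suc {f} h) (antitone-suc {f′} h′) n rest c<n

path-determined : ∀ {top n N f f′} → Path top n f → Path top n f′ → n ≤ N →
  (∀ r → 0 < r → count f N r ≡ count f′ N r) → ∀ c → f c ≡ f′ c
path-determined {N = N} P P′ n≤N e c with c <? N
... | yes c<N = count-determines (Path.descent P) (Path.descent P′) N e c<N
... | no  c≮N = trans (Path.outside P (≤-trans n≤N (≮⇒≥ c≮N))) (sym (Path.outside P′ (≤-trans n≤N (≮⇒≥ c≮N))))

count-cong : ∀ {f f′} → (∀ c → f c ≡ f′ c) → ∀ n r → count f n r ≡ count f′ n r
count-cong e zero    r = refl
count-cong e (suc n) r = cong₂ _+_ (cong (λ v → indicator v r) (e 0)) (count-cong (e ∘ suc) n r)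

module Pair {p q x y} {f g f′ g′ : ℕ → ℕ} (P : Paths p q x y f g) (P′ : Paths p q x y f′ g′)
            (sw : SameWeight (x + y) f g f′ g′) where
  private
    module P = Paths P
    module P′ = Paths P′

  lower-determines : (∀ c → f c ≡ f′ c) → (∀ c → f c ≡ f′ c) × (∀ c → g c ≡ g′ c)
  lower-determines e = e , path-determined P.upper P′.upper (m≤n+m y x) λ r 0<r →
    +-cancelˡ-≡ (count f (x + y) r) _ _ (trans (sw r 0<r) (cong (_+ count g′ (x + y) r) (sym (count-cong e (x + y) r))))

  upper-determines : (∀ c → g c ≡ g′ c) → (∀ c → f c ≡ f′ c) × (∀ c → g c ≡ g′ c)
  upper-determines e = (path-determined P.lower P′.lower (m≤m+n x y) λ r 0<r →
    +-cancelʳ-≡ (count g (x + y) r) _ _ (trans (sw r 0<r) (cong (count f′ (x + y) r +_) (sym (count-cong e (x + y) r))))) , e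

  occupied-transfer : ∀ {r} → 0 < r → Occupied f g r → Occupied f′ g′ r
  occupied-transfer {r} 0<r o = find (subst (0 <_) (sw r 0<r) (positive o))
    where
    positive : Occupied f g r → 0 < weight f g (x + y) r
    positive (c , inj₁ e) = ≤-trans
      (count-positive f (≤-trans (Path.inside⁻¹ P.lower (subst (0 <_) (sym e) 0<r)) (m≤m+n x y)) e) (m≤m+n _ _)
    positive (c , inj₂ e) = ≤-trans
      (count-positive g (≤-trans (Path.inside⁻¹ P.upper (subst (0 <_) (sym e) 0<r)) (m≤n+m y x)) e) (m≤n+m _ _)
    find : 0 < weight f′ g′ (x + y) r → Occupied f′ g′ r
    find h with count f′ (x + y) r in eq
    ... | zero with count-witness g′ (x + y) h
    ...   | c , e = c , inj₂ e
    find h | suc _ with count-witness f′ (x + y) {r} (subst (0 <_) (sym eq) (s≤s z≤n))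
    ...   | c , e = c , inj₁ e

module Analysis {p q x y} {f g : ℕ → ℕ} (p<q : p < q) (0<x : 0 < x) (P : Paths p q x y f g) where
  open Paths P
  module L = Path lower
  module U = Path upper

  0<p : 0 < p
  0<p = ≤-trans (L.inside 0<x) (L.bounded 0)

  Support : ℕ → Set
  Support r = ∃[ c ] ∃[ d ] (c ≤ d × (f c ≡ r × g d ≡ suc r ⊎ g c ≡ r × f d ≡ suc r))

  ascends : ∀ {h : ℕ → ℕ} → Antitone h → ∀ {c d r} → c ≤ d → h c ≡ r → h d ≢ suc r
  ascends {h} anti {c} {d} c≤d refl e = <-irrefl refl (subst (_≤ h c) e (anti c≤d))

  -- A path weakly descends, so a row is supported by the other path.
  support : ∀ {r} → 0 < r → ¬ (r ≡ p × ∃[ c ] f c ≡ p) → r ≢ q → Occupied f g r → Support r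
  support 0<r ¬p ¬q o with supported _ 0<r o
  ... | inj₁ h        = contradiction h ¬p
  ... | inj₂ (inj₁ h) = contradiction (proj₁ h) ¬q
  ... | inj₂ (inj₂ (c , d , c≤d , inj₁ h , inj₁ h′)) = contradiction h′ (ascends L.descent c≤d h)
  ... | inj₂ (inj₂ (c , d , c≤d , inj₁ h , inj₂ h′)) = c , d , c≤d , inj₁ (h , h′)
  ... | inj₂ (inj₂ (c , d , c≤d , inj₂ h , inj₁ h′)) = c , d , c≤d , inj₂ (h , h′)
  ... | inj₂ (inj₂ (c , d , c≤d , inj₂ h , inj₂ h′)) = contradiction h′ (ascends U.descent c≤d h)

  lower-below : ∀ c {r} → f 0 < r → f c ≢ r
  lower-below c lt refl = <⇒≱ lt (L.descent z≤n)

  -- If f 0 < p, row f 0 is supported by an upper cell in the row above. That row is at most p,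
  -- hence is not row q, and it would in turn need a lower cell above row f 0.
  lower-starts : f 0 ≡ p
  lower-starts with m≤n⇒m<n∨m≡n (L.bounded 0)
  ... | inj₂ e  = e
  ... | inj₁ lt with support (L.inside 0<x) (λ (e , _) → <⇒≢ lt e) (<⇒≢ (<-trans lt p<q)) (0 , inj₁ refl)
  ...   | _ , d , _ , inj₂ (_ , e) = contradiction e (lower-below d ≤-refl)
  ...   | _ , d , _ , inj₁ (_ , e)
    with support (s≤s z≤n) (λ (_ , c , e) → lower-below c lt e) (<⇒≢ (≤-<-trans lt p<q)) (d , inj₂ e)
  ...     | c , _ , _ , inj₁ (e′ , _) = contradiction e′ (lower-below c ≤-refl)
  ...     | _ , c , _ , inj₂ (_ , e′) = contradiction e′ (lower-below c (n≤1+n _))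

  support-below : ∀ {r} → 0 < r → r < p → Occupied f g r → Support r
  support-below 0<r r<p = support 0<r (λ (e , _) → <⇒≢ r<p e) (<⇒≢ (<-trans r<p p<q))

  -- A row strictly between p and q would need a lower cell in it or directly above it, but lower
  -- cells lie weakly below row p.
  upper-above : ∀ c → p < g c → g c ≡ q
  upper-above c p<gc with g c ≟ q
  ... | yes e = e
  ... | no ne with support (≤-<-trans z≤n p<gc) (λ (e , _) → <⇒≢ p<gc (sym e)) ne (c , inj₂ refl)
  ...   | d , _ , _ , inj₁ (e , _) = contradiction (subst (_≤ p) e (L.bounded d)) (<⇒≱ p<gc)
  ...   | _ , d , _ , inj₂ (_ , e) = contradiction (subst (_≤ p) e (L.bounded d)) (<⇒≱ (<-trans p<gc ≤-refl))

  -- Condition (iv) propagates: g d < f (suc d) and g (suc d) ≤ g d put g below f again in column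
  -- `suc d`.
  crossed : ∀ {c d} → 0 < g d → g c < f c → c ≤ d → g d < f (suc d)
  crossed {c} {d} 0<gd lt c≤d with m≤n⇒m<n∨m≡n c≤d
  ... | inj₂ refl      = crossing c 0<gd lt
  crossed {c} {suc d} 0<gd lt _ | inj₁ (s≤s c≤d) = crossing (suc d) 0<gd
    (≤-<-trans (U.descent (n≤1+n d)) (crossed (≤-trans 0<gd (U.descent (n≤1+n d))) lt c≤d))

  -- Applied to the last column of g, `crossed` makes f positive in column y, so y < x.
  uncrossed : x ≤ y → ∀ {c} → 0 < g c → ¬ g c < f c
  uncrossed x≤y {c} 0<gc lt with U.inside⁻¹ 0<gc
  ... | s≤s {n = y′} c≤y′ =
    <⇒≱ (L.inside⁻¹ (≤-<-trans z≤n (crossed {c} {y′} (U.inside ≤-refl) lt c≤y′))) x≤y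

  -- Row p is taken in column 0 by f. If g 0 were below row p - 1, row g 0 would be supported by a
  -- lower cell one row up, and that row by an upper cell above row g 0.
  upper-starts : 0 < y → g 0 ≡ q ⊎ suc (g 0) ≡ p
  upper-starts 0<y with <-cmp (g 0) p
  ... | tri> _ _ gt = inj₁ (upper-above 0 gt)
  ... | tri≈ _ e _  = contradiction (trans lower-starts (sym e)) (disjoint 0 (L.inside 0<x))
  ... | tri< lt _ _ with support-below (U.inside 0<y) lt (0 , inj₂ refl)
  ...   | _ , d , _ , inj₁ (_ , e) = contradiction (subst (_≤ g 0) e (U.descent z≤n)) (<⇒≱ ≤-refl)
  ...   | _ , d , _ , inj₂ (_ , e) with m≤n⇒m<n∨m≡n lt
  ...     | inj₂ e′ = inj₂ e′
  ...     | inj₁ lt′ with support-below (s≤s z≤n) lt′ (d , inj₁ e)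
  ...       | _ , d′ , _ , inj₁ (_ , e′) = contradiction (subst (_≤ g 0) e′ (U.descent z≤n)) (<⇒≱ (n≤1+n _))
  ...       | c  , _ , _ , inj₂ (e′ , _) = contradiction (subst (_≤ g 0) e′ (U.descent z≤n)) (<⇒≱ ≤-refl)

  -- Support of an upper cell by a lower one weakly to its right would put g below f in the column
  -- of the upper cell, as f descends.
  uncrossed-support : x ≤ y → ∀ {r} → 0 < r → r < p → Occupied f g r →
                      ∃[ c ] ∃[ d ] (c ≤ d × f c ≡ r × g d ≡ suc r)
  uncrossed-support x≤y 0<r r<p o with support-below 0<r r<p o
  ... | c , d , c≤d , inj₁ (e , e′) = c , d , c≤d , e , e′
  ... | c , d , c≤d , inj₂ (refl , e′) =
    contradiction (≤-trans (≤-reflexive (sym e′)) (L.descent c≤d)) (uncrossed x≤y 0<r)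

count-stable : ∀ {top n f} → Path top n f → ∀ {N r} → n ≤ N → 0 < r → count f N r ≡ count f n r
count-stable {f = f} P n≤N 0<r = go f n≤N λ n≤c e → <⇒≢ 0<r (trans (sym (Path.outside P n≤c)) e)
  where
  go : ∀ f {n N r} → n ≤ N → (∀ {c} → n ≤ c → f c ≢ r) → count f N r ≡ count f n r
  go f {N = N} z≤n       h = count≡0 f N λ c → h z≤n
  go f {r = r} (s≤s n≤N) h = cong (indicator (f 0) r +_) (go (f ∘ suc) n≤N (h ∘ s≤s))

count-prefix : ∀ f k {n r} → k ≤ n → (∀ {c} → c < k → f c ≡ r) → k ≤ count f n r
count-prefix f zero    _         _ = z≤n
count-prefix f (suc k) {suc n} {r} (s≤s k≤n) h = subst (λ i → suc k ≤ i + count (f ∘ suc) n r)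
  (sym (indicator-≡ (h (s≤s z≤n)))) (s≤s (count-prefix (f ∘ suc) k k≤n (h ∘ s≤s)))

-- Shapes with a part equal to 1 or 2

pointwise₁ : ∀ {top f f′} → Path top 1 f → Path top 1 f′ → f 0 ≡ f′ 0 → ∀ c → f c ≡ f′ c
pointwise₁ P P′ e zero    = e
pointwise₁ P P′ e (suc c) = trans (Path.outside P (s≤s z≤n)) (sym (Path.outside P′ (s≤s z≤n)))

pointwise₂ : ∀ {top f f′} → Path top 2 f → Path top 2 f′ → f 0 ≡ f′ 0 → f 1 ≡ f′ 1 → ∀ c → f c ≡ f′ c
pointwise₂ P P′ e e′ zero          = e
pointwise₂ P P′ e e′ (suc zero)    = e′
pointwise₂ P P′ e e′ (suc (suc c)) =
  trans (Path.outside P (s≤s (s≤s z≤n))) (sym (Path.outside P′ (s≤s (s≤s z≤n))))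

avoids : ∀ {top f r} → Path top 2 f → 0 < r → f 0 ≢ r → f 1 ≢ r → ∀ c → f c ≢ r
avoids P 0<r h h′ zero          = h
avoids P 0<r h h′ (suc zero)    = h′
avoids P 0<r h h′ (suc (suc c)) e = <⇒≢ 0<r (trans (sym (Path.outside P (s≤s (s≤s z≤n)))) e)

module _ {p q : ℕ} (p<q : p < q) where

  -- Row q tells the two starts apart: if g′ starts in row p - 1, the second tableau lies weakly
  -- below row p.
  upper-top-transfer : ∀ {x y f g f′ g′} → (P : Paths p q x y f g) (P′ : Paths p q x y f′ g′) →
    SameWeight (x + y) f g f′ g′ → g 0 ≡ q → suc (g′ 0) ≢ p
  upper-top-transfer P P′ sw e e′ with Pair.occupied-transfer P P′ sw (≤-<-trans z≤n p<q) (0 , inj₂ e)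
  ... | c , inj₁ e″ = <⇒≱ p<q (subst (_≤ p) e″ (Path.bounded (Paths.lower P′) c))
  ... | c , inj₂ e″ = <⇒≱ (<-trans (≤-reflexive e′) p<q) (subst (_≤ _) e″ (Path.descent (Paths.upper P′) z≤n))

  upper-starts-equal : ∀ {x y f g f′ g′} → 0 < x → 0 < y →
    Paths p q x y f g → Paths p q x y f′ g′ → SameWeight (x + y) f g f′ g′ → g 0 ≡ g′ 0
  upper-starts-equal 0<x 0<y P P′ sw
    with Analysis.upper-starts p<q 0<x P 0<y | Analysis.upper-starts p<q 0<x P′ 0<y
  ... | inj₁ e | inj₁ e′ = trans e (sym e′)
  ... | inj₂ e | inj₂ e′ = suc-injective (trans e (sym e′))
  ... | inj₁ e | inj₂ e′ = contradiction e′ (upper-top-transfer P P′ sw e)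
  ... | inj₂ e | inj₁ e′ = contradiction e (upper-top-transfer P′ P (λ r 0<r → sym (sw r 0<r)) e′)

  determined-1-y : ∀ {y} → Determined p q 1 y
  determined-1-y P P′ sw = Pair.lower-determines P P′ sw
    (pointwise₁ (Paths.lower P) (Paths.lower P′)
      (trans (Analysis.lower-starts p<q ≤-refl P) (sym (Analysis.lower-starts p<q ≤-refl P′))))

  determined-x-1 : ∀ {x} → 0 < x → Determined p q x 1
  determined-x-1 0<x P P′ sw = Pair.upper-determines P P′ sw
    (pointwise₁ (Paths.upper P) (Paths.upper P′) (upper-starts-equal 0<x ≤-refl P P′ sw))

  -- If f 1 < p - 1, row f 1 is supported by an upper cell one row up. By `uncrossed-support` that
  -- row contains a lower cell too, but f takes only the values p and f 1.
  lower₂-second : ∀ {y f g} → 2 ≤ y → Paths p q 2 y f g → f 1 ≡ p ⊎ suc (f 1) ≡ p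
  lower₂-second {y} {f} {g} 2≤y P with m≤n⇒m<n∨m≡n (L.bounded 1)
    where open Analysis p<q (s≤s z≤n) P
  ... | inj₂ e  = inj₁ e
  ... | inj₁ lt = inj₂ (next (m≤n⇒m<n∨m≡n lt))
    where
    open Analysis p<q (s≤s z≤n) P
    next : suc (f 1) < p ⊎ suc (f 1) ≡ p → suc (f 1) ≡ p
    next (inj₂ e)   = e
    next (inj₁ lt′) with uncrossed-support 2≤y (L.inside ≤-refl) lt (1 , inj₁ refl)
    ... | _ , d , _ , _ , e with uncrossed-support 2≤y (s≤s z≤n) lt′ (d , inj₂ e)
    ...   | c , _ , _ , e′ , _ = contradiction e′ (avoids (Paths.lower P) (s≤s z≤n)
            (λ e″ → <⇒≢ lt′ (trans (sym e″) lower-starts)) (λ e″ → <⇒≢ ≤-refl e″) c)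

  -- Otherwise row p - 1 would be occupied in both tableaux, and in the first its support needs a
  -- lower cell in row p - 1, while both lower cells are in row p.
  lower₂-transfer : ∀ {y f g f′ g′} → 2 ≤ y → (P : Paths p q 2 y f g) (P′ : Paths p q 2 y f′ g′) →
    SameWeight (2 + y) f g f′ g′ → f 1 ≡ p → suc (f′ 1) ≢ p
  lower₂-transfer {f = f} {f′ = f′} 2≤y P P′ sw e e′
    with uncrossed-support 2≤y 0<s (≤-reflexive e′) (Pair.occupied-transfer P′ P (λ r 0<r → sym (sw r 0<r)) 0<s (1 , inj₁ refl))
    where
    open Analysis p<q (s≤s z≤n) P
    0<s = Path.inside (Paths.lower P′) (≤-refl {2})
  ... | c , _ , _ , e″ , _ = avoids (Paths.lower P) (Path.inside (Paths.lower P′) ≤-refl)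
        (λ h → <⇒≢ (≤-reflexive e′) (trans (sym h) (Analysis.lower-starts p<q (s≤s z≤n) P)))
        (λ h → <⇒≢ (≤-reflexive e′) (trans (sym h) e)) c e″

  determined-2-y : ∀ {y} → 2 ≤ y → Determined p q 2 y
  determined-2-y 2≤y {f} {g} {f′} {g′} P P′ sw = Pair.lower-determines P P′ sw
    (pointwise₂ (Paths.lower P) (Paths.lower P′)
      (trans (Analysis.lower-starts p<q (s≤s z≤n) P) (sym (Analysis.lower-starts p<q (s≤s z≤n) P′)))
      (second (lower₂-second 2≤y P) (lower₂-second 2≤y P′)))
    where
    second : f 1 ≡ p ⊎ suc (f 1) ≡ p → f′ 1 ≡ p ⊎ suc (f′ 1) ≡ p → f 1 ≡ f′ 1
    second (inj₁ e) (inj₁ e′) = trans e (sym e′)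
    second (inj₂ e) (inj₂ e′) = suc-injective (trans e (sym e′))
    second (inj₁ e) (inj₂ e′) = contradiction e′ (lower₂-transfer 2≤y P P′ sw e)
    second (inj₂ e) (inj₁ e′) = contradiction e (lower₂-transfer 2≤y P′ P (λ r 0<r → sym (sw r 0<r)) e′)

  module _ {x f g} (2≤x : 2 ≤ x) (P : Paths p q x 2 f g) where
    private
      0<x = <⇒≤ 2≤x
      0<g1 : 0 < g 1
      0<g1 = Path.inside (Paths.upper P) (s≤s (s≤s z≤n))
    open Paths P
    open Analysis p<q 0<x P using (module L; module U; lower-starts; upper-above; support-below; crossed)

    -- Were g 1 < p - 1, row g 1 would be supported by a lower cell one row up, and that row would
    -- need an upper cell between g 1 and row p, where g has none.
    upper₂-second-high : g 0 ≡ q → g 1 ≡ q ⊎ g 1 ≡ p ⊎ suc (g 1) ≡ p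
    upper₂-second-high e₀ with <-cmp (g 1) p
    ... | tri> _ _ gt = inj₁ (upper-above 1 gt)
    ... | tri≈ _ e _  = inj₂ (inj₁ e)
    ... | tri< lt _ _ = inj₂ (inj₂ (next (m≤n⇒m<n∨m≡n lt)))
      where
      misses : ∀ {r} → g 1 < r → r ≤ p → ∀ c → g c ≢ r
      misses lt le = avoids upper (≤-<-trans z≤n lt)
        (λ e → <⇒≱ p<q (subst (_≤ p) (trans (sym e) e₀) le)) (λ e → <⇒≢ lt e)
      next : suc (g 1) < p ⊎ suc (g 1) ≡ p → suc (g 1) ≡ p
      next (inj₂ e)   = e
      next (inj₁ lt′) with support-below 0<g1 lt (1 , inj₂ refl)
      ... | _ , d , _ , inj₁ (_ , e) = contradiction e (misses ≤-refl lt d)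
      ... | _ , d , _ , inj₂ (_ , e) with support-below (s≤s z≤n) lt′ (d , inj₁ e)
      ...   | _ , d′ , _ , inj₁ (_ , e′) = contradiction e′ (misses (n≤1+n _) lt′ d′)
      ...   | c  , _ , _ , inj₂ (e′ , _) = contradiction e′ (misses ≤-refl lt c)

    -- The same double support as for a high start, except that now g 0 itself could serve as the
    -- supporting cell.
    upper₂-second-low : suc (g 0) ≡ p → g 1 ≡ g 0 ⊎ suc (g 1) ≡ g 0
    upper₂-second-low e₀ with m≤n⇒m<n∨m≡n (U.descent (z≤n {1}))
    ... | inj₂ e  = inj₁ e
    ... | inj₁ lt = inj₂ (next (m≤n⇒m<n∨m≡n lt))
      where
      g0<p : g 0 < p
      g0<p = ≤-reflexive e₀
      next : suc (g 1) < g 0 ⊎ suc (g 1) ≡ g 0 → suc (g 1) ≡ g 0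
      next (inj₂ e)   = e
      next (inj₁ lt′) with support-below 0<g1 (<-trans lt g0<p) (1 , inj₂ refl)
      ... | _ , d , _ , inj₁ (_ , e) = contradiction e
            (avoids upper (s≤s z≤n) (λ e → <⇒≢ lt′ (sym e)) (λ e → <⇒≢ ≤-refl e) d)
      ... | _ , d , _ , inj₂ (_ , e) with support-below (s≤s z≤n) (<-trans lt′ g0<p) (d , inj₁ e)
      ...   | c , _ , _ , inj₂ (e′ , _) = contradiction e′
              (avoids upper (s≤s z≤n) (λ e → <⇒≢ lt′ (sym e)) (λ e → <⇒≢ ≤-refl e) c)
      -- Support by g 0 forces column 0 for the lower cell, but f 0 = p is higher than row g 1 + 1.
      ...   | zero , zero  , _ , inj₁ (e′ , _) =
              contradiction (trans (sym e′) lower-starts) (<⇒≢ (<-trans lt′ g0<p))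
      ...   | _ , suc zero , _ , inj₁ (_ , e′) = contradiction e′ (<⇒≢ (n≤1+n _))
      ...   | _ , suc (suc d′) , _ , inj₁ (_ , e′) =
              contradiction (trans (sym (U.outside (s≤s (s≤s z≤n)))) e′) λ ()

  private
    2≤+2 : ∀ x → 2 ≤ x + 2
    2≤+2 x = m≤n+m 2 x

  -- The possible second values are told apart by the count of row q, by the count of row p, or, if
  -- g 0 = p - 1, by the support of row p - 2.
  upper₂-not-less : ∀ {x f g f′ g′} → 2 ≤ x → (P : Paths p q x 2 f g) (P′ : Paths p q x 2 f′ g′) →
    SameWeight (x + 2) f g f′ g′ → g 0 ≡ g′ 0 → ¬ g 1 < g′ 1
  upper₂-not-less {x} {f} {g} {f′} {g′} 2≤x P P′ sw e₀ lt = start (A.upper-starts (s≤s z≤n))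
    where
    0<x = <⇒≤ 2≤x
    module A  = Analysis p<q 0<x P
    module A′ = Analysis p<q 0<x P′
    0<q = ≤-<-trans z≤n p<q
    count-g : ∀ {r} → 0 < r → count g (x + 2) r ≡ indicator (g 0) r + (indicator (g 1) r + 0)
    count-g = count-stable (Paths.upper P) (2≤+2 x)
    count-g′ : ∀ {r} → 0 < r → count g′ (x + 2) r ≡ indicator (g′ 0) r + (indicator (g′ 1) r + 0)
    count-g′ = count-stable (Paths.upper P′) (2≤+2 x)
    lower-misses : ∀ {f} → Path p x f → ∀ {r} → p < r → count f (x + 2) r ≡ 0
    lower-misses {f} Q p<r = count≡0 f (x + 2) λ c e → <⇒≱ p<r (subst (_≤ p) e (Path.bounded Q c))

    second-q : g 0 ≡ q → g′ 1 ≢ q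
    second-q e e′ = contradiction (trans (sym one) (trans (sw q 0<q) two)) λ ()
      where
      one : weight f g (x + 2) q ≡ 1
      one = cong₂ _+_ (lower-misses (Paths.lower P) p<q) (trans (count-g 0<q)
        (cong₂ (λ i j → i + (j + 0)) (indicator-≡ e) (indicator-≢ (<⇒≢ (subst (g 1 <_) e′ lt)))))
      two : weight f′ g′ (x + 2) q ≡ 2
      two = cong₂ _+_ (lower-misses (Paths.lower P′) p<q) (trans (count-g′ 0<q)
        (cong₂ (λ i j → i + (j + 0)) (indicator-≡ (trans (sym e₀) e)) (indicator-≡ e′)))

    -- The support of row p - 1 = g 1 forces f 1 = p, so g runs under f and (iv) gives f 2 = p: at
    -- least three cells in row p. In P′ only f′ 0 and g′ 1 are there, since f′ 1 must avoid g′ 1 =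
    -- p.
    second-p : g 0 ≡ q → suc (g 1) ≡ p → g′ 1 ≢ p
    second-p e es e′ = <⇒≱ ≤-refl (≤-trans three (≤-reflexive (trans (sw p A.0<p) two)))
      where
      0<g1 = A.U.inside ≤-refl
      f1 : g 1 < f 1
      f1 with A.support-below 0<g1 (≤-reflexive es) (1 , inj₂ refl)
      ... | _ , d , _ , inj₁ (_ , h) = contradiction h (avoids (Paths.upper P) (s≤s z≤n)
            (λ h → <⇒≢ p<q (trans (sym es) (trans (sym h) e))) (λ h → <⇒≢ ≤-refl h) d)
      ... | zero  , _ , _ , inj₂ (h , _) = contradiction (trans (sym h) e) (<⇒≢ (<-trans (≤-reflexive es) p<q))
      ... | suc _ , d , c≤d , inj₂ (_ , h) = ≤-trans (≤-reflexive (sym h)) (A.L.descent (≤-trans (s≤s z≤n) c≤d))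
      three : 3 ≤ weight f g (x + 2) p
      three = ≤-trans (count-prefix f 3 (≤-trans (s≤s 2≤x) (subst (_≤ x + 2) (+-comm x 1) (+-monoʳ-≤ x (n≤1+n 1)))) at-p)
                      (m≤m+n _ _)
        where
        at-p : ∀ {c} → c < 3 → f c ≡ p
        at-p (s≤s c≤2) = ≤-antisym (A.L.bounded _)
          (≤-trans (≤-reflexive (sym es)) (≤-trans (A.crossed 0<g1 f1 ≤-refl) (A.L.descent c≤2)))
      two : weight f′ g′ (x + 2) p ≡ 2
      two = cong₂ _+_ (count-head (≤-trans 0<x (m≤m+n x 2)) A′.lower-starts below)
        (trans (count-g′ A.0<p) (cong₂ (λ i j → i + (j + 0))
          (indicator-≢ λ h → <⇒≢ p<q (trans (sym h) (trans (sym e₀) e))) (indicator-≡ e′)))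
        where
        below : ∀ c → f′ (suc c) < p
        below c = ≤-<-trans (A′.L.descent (s≤s z≤n)) (≤∧≢⇒< (A′.L.bounded 1)
          λ h → Paths.disjoint P′ 1 (A′.L.inside 2≤x) (trans h (sym e′)))
        count-head : ∀ {h r n} → 0 < n → h 0 ≡ r → (∀ c → h (suc c) < r) → count h n r ≡ 1
        count-head {h} {n = suc n} _ e lt =
          cong₂ _+_ (indicator-≡ e) (count≡0 (h ∘ suc) n λ c e′ → <⇒≢ (lt c) e′)

    -- Row p - 2 is occupied in P too, hence in P′, where both upper cells are in row p - 1. Its
    -- support is a lower cell in some column c; but g′ is under f′ from column 0 on, so f′ (suc c)
    -- > p - 1, against descent from f′ c = p - 2.
    second-low : suc (g 0) ≡ p → suc (g 1) ≡ g 0 → g′ 1 ≢ g′ 0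
    second-low e es e′ with A′.support-below 0<g1 g1<p (Pair.occupied-transfer P P′ sw 0<g1 (1 , inj₂ refl))
      where
      0<g1 = A.U.inside ≤-refl
      g1<p = <-trans (≤-reflexive es) (≤-reflexive e)
    ... | c , d , c≤d , inj₁ (h , h′) = <-asym
      (A′.crossed 0<g′c (subst (g′ 0 <_) (sym A′.lower-starts) (≤-reflexive (trans (cong suc (sym e₀)) e))) z≤n)
      (≤-<-trans (A′.L.descent (n≤1+n c)) (≤-trans (≤-reflexive (trans (cong suc h) (sym h′))) (A′.U.descent c≤d)))
      where
      0<g′c : 0 < g′ c
      0<g′c = ≤-trans (subst (0 <_) (sym h′) (s≤s z≤n)) (A′.U.descent c≤d)
    ... | c , _ , _ , inj₂ (h , _) = avoids (Paths.upper P′) (A.U.inside ≤-refl)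
      (λ h → <⇒≢ (≤-reflexive es) (trans (sym h) (sym e₀)))
      (λ h → <⇒≢ (≤-reflexive es) (trans (sym h) (trans e′ (sym e₀)))) c h

    start : g 0 ≡ q ⊎ suc (g 0) ≡ p → ⊥
    start (inj₁ e) with upper₂-second-high 2≤x P e | upper₂-second-high 2≤x P′ (trans (sym e₀) e)
    ... | _             | inj₁ h′        = second-q e h′
    ... | inj₁ h        | inj₂ _         = <⇒≱ lt (subst (g′ 1 ≤_) (sym h) (A′.U.bounded 1))
    ... | inj₂ (inj₁ h) | inj₂ (inj₁ h′) = <⇒≢ lt (trans h (sym h′))
    ... | inj₂ (inj₁ h) | inj₂ (inj₂ h′) = <-asym lt (≤-reflexive (trans h′ (sym h)))
    ... | inj₂ (inj₂ h) | inj₂ (inj₁ h′) = second-p e h h′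
    ... | inj₂ (inj₂ h) | inj₂ (inj₂ h′) = <⇒≢ lt (suc-injective (trans h (sym h′)))
    start (inj₂ e) with upper₂-second-low 2≤x P e | upper₂-second-low 2≤x P′ (trans (cong suc (sym e₀)) e)
    ... | inj₁ h | _       = <⇒≱ lt (≤-trans (A′.U.descent z≤n) (≤-reflexive (trans (sym e₀) (sym h))))
    ... | inj₂ h | inj₁ h′ = second-low e h h′
    ... | inj₂ h | inj₂ h′ = <⇒≢ lt (suc-injective (trans h (trans e₀ (sym h′))))

  determined-x-2 : ∀ {x} → 2 ≤ x → Determined p q x 2
  determined-x-2 2≤x P P′ sw = Pair.upper-determines P P′ sw
    (pointwise₂ (Paths.upper P) (Paths.upper P′) e₀
      (≤-antisym (≮⇒≥ (upper₂-not-less 2≤x P′ P (λ r 0<r → sym (sw r 0<r)) (sym e₀)))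
                 (≮⇒≥ (upper₂-not-less 2≤x P P′ sw e₀))))
    where
    e₀ = upper-starts-equal (<⇒≤ 2≤x) (s≤s z≤n) P P′ sw

-- Finite search

-- Weakly increasing lists of length n over the range from lo to lo + k: either lo is the first
-- entry, or the range shrinks to start at `suc lo`.
ascending : ℕ → ℕ → ℕ → List (List ℕ)
ascending lo k       zero    = [] ∷ []
ascending lo zero    (suc n) = map (lo ∷_) (ascending lo zero n)
ascending lo (suc k) (suc n) = map (lo ∷_) (ascending lo (suc k) n) ++ ascending (suc lo) k (suc n)

-- A decidable form of one half of `Supported`; membership in the suffix that includes the current
-- column expresses c ≤ d.
Ascent : ℕ → List ℕ → List ℕ → Set
Ascent s []      _       = ⊥
Ascent s (u ∷ F) []      = ⊥
Ascent s (u ∷ F) (v ∷ G) = (u ≡ suc s × s ∈ v ∷ G) ⊎ Ascent s F G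

ascent? : ∀ s F G → Dec (Ascent s F G)
ascent? s []      _       = no λ ()
ascent? s (u ∷ F) []      = no λ ()
ascent? s (u ∷ F) (v ∷ G) = ((u ≟ suc s) ×-dec (s ∈? v ∷ G)) ⊎-dec ascent? s F G

-- Codes 0 and 1 ask for nothing: row q is occupied only by entries q, and row p contains the first
-- entry p.
Held : List ℕ → List ℕ → ℕ → Set
Held F G (suc (suc s)) = Ascent (suc s) F G ⊎ Ascent (suc s) G F
Held F G _             = ⊤

held? : ∀ F G s → Dec (Held F G s)
held? F G (suc (suc s)) = ascent? (suc s) F G ⊎-dec ascent? (suc s) G F
held? F G zero          = yes tt
held? F G (suc zero)    = yes tt

Valid : List ℕ × List ℕ → Set
Valid (F , G) = Compatible F G × All (Held F G) F × All (Held F G) G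

valid? : ∀ FG → Dec (Valid FG)
valid? (F , G) = compatible? F G ×-dec all? (held? F G) F ×-dec all? (held? F G) G

-- The lower path has length suc m and starts with code 1; no code exceeds the number
-- suc m + y of cells.
candidates : ℕ → ℕ → List (List ℕ × List ℕ)
candidates m y = cartesianProduct (map (1 ∷_) (ascending 1 (m + y) m)) (ascending 0 (suc m + y) y)

valids : ℕ → ℕ → List (List ℕ × List ℕ)
valids m y = filter valid? (candidates m y)

occurrences : ℕ → List ℕ → ℕ
occurrences s []      = 0
occurrences s (u ∷ F) = indicator u s + occurrences s F

SameOccurrences : ℕ → (F G F′ G′ : List ℕ) → Set
SameOccurrences B F G F′ G′ =
  All (λ s → occurrences s F + occurrences s G ≡ occurrences s F′ + occurrences s G′) (upTo B)

-- Comparing lower lists is enough, as the weight then fixes the upper path.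
SeparatedIn : ℕ → List (List ℕ × List ℕ) → Set
SeparatedIn B V = All (λ (F , G) → All (λ (F′ , G′) → SameOccurrences B F G F′ G′ → F ≡ F′) V) V

separatedIn? : ∀ B V → Dec (SeparatedIn B V)
separatedIn? B V = all? (λ (F , G) → all? (λ (F′ , G′) →
  all? (λ s → occurrences s F + occurrences s G ≟ occurrences s F′ + occurrences s G′) (upTo B)
  →-dec ≡-dec _≟_ F F′) V) V

-- With x = suc m, the codes 0, ..., x + y are 2 + m + y in number.
Separated : ℕ → ℕ → Set
Separated m y = SeparatedIn (2 + m + y) (valids m y)

separated? : ∀ m y → Dec (Separated m y)
separated? m y = separatedIn? (2 + m + y) (valids m y)

separated-3-3 : Separated 2 3
separated-3-3 = from-yes (separated? 2 3)

separated-4-3 : Separated 3 3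
separated-4-3 = from-yes (separated? 3 3)

separated-4-4 : Separated 3 4
separated-4-4 = from-yes (separated? 3 4)

∈-ascending : ∀ {lo} k {L} → Linked _≤_ (lo ∷ L) → All (_≤ lo + k) L → L ∈ ascending lo k (length L)
∈-ascending k {[]} _ _ = here refl
∈-ascending {lo} zero {u ∷ L} (lo≤u ∷ l) (u≤ ∷ bs) = subst (λ v → v ∷ L ∈ ascending lo 0 (suc (length L))) lo≡u
  (∈-map⁺ (lo ∷_) (∈-ascending zero (subst (λ v → Linked _≤_ (v ∷ L)) (sym lo≡u) l) bs))
  where
  lo≡u : lo ≡ u
  lo≡u = ≤-antisym lo≤u (subst (u ≤_) (+-identityʳ lo) u≤)
∈-ascending {lo} (suc k) {u ∷ L} (lo≤u ∷ l) (u≤ ∷ bs) =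
  [ (λ lo<u → ∈-++⁺ʳ (map (lo ∷_) (ascending lo (suc k) (length L)))
      (∈-ascending k (lo<u ∷ l) (subst (λ b → All (_≤ b) (u ∷ L)) (+-suc lo k) (u≤ ∷ bs))))
  , (λ lo≡u → subst (λ v → v ∷ L ∈ ascending lo (suc k) (suc (length L))) lo≡u
      (∈-++⁺ˡ (∈-map⁺ (lo ∷_) (∈-ascending (suc k) (subst (λ v → Linked _≤_ (v ∷ L)) (sym lo≡u) l) bs))))
  ]′ (m≤n⇒m<n∨m≡n lo≤u)

-- From paths to codes

module Coding (p q : ℕ) (p<q : p < q) where
  open Rows p q p<q

  Value : ℕ → Set
  Value v = 0 < v × (v ≤ p ⊎ v ≡ q)

  code : ℕ → ℕ
  code v with v ≟ q
  ... | yes _ = 0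
  ... | no  _ = suc (p ∸ v)

  code≤p : ∀ {v} → Value v → code v ≤ p
  code≤p {v} (0<v , h) with v ≟ q | h
  ... | yes _ | _         = z≤n
  ... | no _  | inj₁ v≤p  = ∸-monoʳ-< {p} 0<v v≤p
  ... | no v≢q | inj₂ v≡q = contradiction v≡q v≢q

  row-code : ∀ {v} → Value v → row (code v) ≡ v
  row-code {v} (0<v , h) with v ≟ q | h
  ... | yes v≡q | _       = sym v≡q
  ... | no _  | inj₁ v≤p  = m∸[m∸n]≡n v≤p
  ... | no v≢q | inj₂ v≡q = contradiction v≡q v≢q

  code-injective : ∀ {u v} → Value u → Value v → code u ≡ code v → u ≡ v
  code-injective hu hv e = trans (sym (row-code hu)) (trans (cong row e) (row-code hv))

  code-row : ∀ {v s} → Value v → s ≤ p → v ≡ row s → code v ≡ s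
  code-row h s≤p e = row-injective (code≤p h) s≤p (trans (row-code h) e)

  code-antitone : ∀ {u v} → Value u → Value v → u ≤ v → code v ≤ code u
  code-antitone {u} {v} hu hv u≤v with code v ≤? code u
  ... | yes h = h
  ... | no ¬h = contradiction (subst₂ _<_ (row-code hv) (row-code hu) (row-strict (code≤p hv) (≰⇒> ¬h))) (≤⇒≯ u≤v)

  code-reflects-< : ∀ {u v} → Value u → Value v → code u < code v → v < u
  code-reflects-< hu hv lt = subst₂ _<_ (row-code hv) (row-code hu) (row-strict (code≤p hv) lt)

  code-strict : ∀ {u v} → Value u → Value v → v < u → code u < code v
  code-strict hu hv lt = row-strict⁻¹ (subst₂ _<_ (sym (row-code hv)) (sym (row-code hu)) lt)

  codes : (ℕ → ℕ) → ℕ → List ℕ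
  codes h zero    = []
  codes h (suc n) = code (h 0) ∷ codes (h ∘ suc) n

  Values : (ℕ → ℕ) → ℕ → Set
  Values h n = ∀ {c} → c < n → Value (h c)

  length-codes : ∀ h n → length (codes h n) ≡ n
  length-codes h zero    = refl
  length-codes h (suc n) = cong suc (length-codes (h ∘ suc) n)

  codes-All : ∀ {P : ℕ → Set} h n → (∀ {c} → c < n → P (code (h c))) → All P (codes h n)
  codes-All h zero    _ = []
  codes-All h (suc n) f = f (s≤s z≤n) ∷ codes-All (h ∘ suc) n (f ∘ s≤s)

  codes-∈ : ∀ h {n c} → c < n → code (h c) ∈ codes h n
  codes-∈ h {suc n} {zero}  _         = here refl
  codes-∈ h {suc n} {suc c} (s≤s c<n) = there (codes-∈ (h ∘ suc) c<n)

  codes-injective : ∀ {h h′ n} → Values h n → Values h′ n → codes h n ≡ codes h′ n → ∀ {c} → c < n → h c ≡ h′ c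
  codes-injective {n = suc n} v v′ e {zero}  _         =
    code-injective (v (s≤s z≤n)) (v′ (s≤s z≤n)) (proj₁ (∷-injective e))
  codes-injective {h} {h′} {suc n} v v′ e {suc c} (s≤s c<n) =
    codes-injective {h ∘ suc} {h′ ∘ suc} (v ∘ s≤s) (v′ ∘ s≤s) (proj₂ (∷-injective e)) c<n

  codes-linked : ∀ {lo} h n → Values h n → Antitone h → (0 < n → lo ≤ code (h 0)) → Linked _≤_ (lo ∷ codes h n)
  codes-linked h zero    _ _ _  = [-]
  codes-linked h (suc n) v a lo = lo (s≤s z≤n) ∷ codes-linked (h ∘ suc) n (v ∘ s≤s) (a ∘ s≤s)
    λ { (s≤s _) → code-antitone (v (s≤s (s≤s z≤n))) (v (s≤s z≤n)) (a z≤n) }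

  indicator-code : ∀ {v s} → Value v → s ≤ p → indicator (code v) s ≡ indicator v (row s)
  indicator-code {v} {s} h s≤p with v ≟ row s
  ... | yes e = indicator-≡ (code-row h s≤p e)
  ... | no ne = indicator-≢ λ e → ne (trans (sym (row-code h)) (cong row e))

  occurrences-codes : ∀ h n {s} → Values h n → s ≤ p → occurrences s (codes h n) ≡ count h n (row s)
  occurrences-codes h zero    _ _   = refl
  occurrences-codes h (suc n) v s≤p =
    cong₂ _+_ (indicator-code (v (s≤s z≤n)) s≤p) (occurrences-codes (h ∘ suc) n (v ∘ s≤s) s≤p)

  -- The search counts codes up to x + y, which may exceed p; such codes stand for no row and occur
  -- in neither tableau.
  occurrences-codes-above : ∀ h n {s} → Values h n → p < s → occurrences s (codes h n) ≡ 0
  occurrences-codes-above h zero    _ _   = refl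
  occurrences-codes-above h (suc n) v p<s = cong₂ _+_
    (indicator-≢ λ e → <⇒≱ p<s (subst (_≤ p) e (code≤p (v (s≤s z≤n)))))
    (occurrences-codes-above (h ∘ suc) n (v ∘ s≤s) p<s)

  codes-compatible : ∀ f g x y → Values f x → Values g y →
    (∀ {c} → c < x → f c ≢ g c) →
    (∀ {c} → c < y → g c < f c → suc c < x × g c < f (suc c)) →
    Compatible (codes f x) (codes g y)
  codes-compatible f g zero    y       _  _  _ _ = tt
  codes-compatible f g (suc x) zero    _  _  _ _ = tt
  codes-compatible f g (suc x) (suc y) vf vg d cr =
    (λ e → d (s≤s z≤n) (code-injective (vf (s≤s z≤n)) (vg (s≤s z≤n)) e)) ,
    (λ lt → below x vf (cr (s≤s z≤n) (code-reflects-< (vf (s≤s z≤n)) (vg (s≤s z≤n)) lt))) ,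
    codes-compatible (f ∘ suc) (g ∘ suc) x y (vf ∘ s≤s) (vg ∘ s≤s) (d ∘ s≤s)
      λ c<y lt → ≤-pred (proj₁ (cr (s≤s c<y) lt)) , proj₂ (cr (s≤s c<y) lt)
    where
    below : ∀ x → Values f (suc x) → 1 < suc x × g 0 < f 1 → Below (codes (f ∘ suc) x) (code (g 0))
    below (suc x) vf (_ , lt) = code-strict (vf (s≤s (s≤s z≤n))) (vg (s≤s z≤n)) lt
    below zero    vf (s≤s () , _)

  codes-ascent : ∀ f g {x y c d t} → c ≤ d → c < x → d < y → code (f c) ≡ suc t → code (g d) ≡ t →
                 Ascent t (codes f x) (codes g y)
  codes-ascent f g {suc x} {suc y} {zero}          _         _         d<y       e refl = inj₁ (e , codes-∈ g d<y)
  codes-ascent f g {suc x} {suc y} {suc c} {suc d} (s≤s c≤d) (s≤s c<x) (s≤s d<y) e e′   =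
    inj₂ (codes-ascent (f ∘ suc) (g ∘ suc) c≤d c<x d<y e e′)

  module _ {x y f g} (0<x : 0 < x) (P : Paths p q x y f g) where
    open Paths P
    open Analysis p<q 0<x P

    lower-values : Values f x
    lower-values c<x = L.inside c<x , inj₁ (L.bounded _)

    upper-values : Values g y
    upper-values {c} c<y with g c ≤? p
    ... | yes h = U.inside c<y , inj₁ h
    ... | no ¬h = U.inside c<y , inj₂ (upper-above c (≰⇒> ¬h))

    occupied-value : ∀ {r} → 0 < r → Occupied f g r → Value r
    occupied-value 0<r (c , inj₁ refl) = lower-values (L.inside⁻¹ 0<r)
    occupied-value 0<r (c , inj₂ refl) = upper-values (U.inside⁻¹ 0<r)

    climb : ∀ {r} → 0 < r → Occupied f g r → ∀ i → r + i ≤ p → Occupied f g (r + i)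
    climb {r} 0<r o zero    _  = subst (Occupied f g) (sym (+-identityʳ r)) o
    climb {r} 0<r o (suc i) le = subst (Occupied f g) (sym (+-suc r i))
      (next (support-below (≤-trans 0<r (m≤m+n r i)) lt (climb 0<r o i (<⇒≤ lt))))
      where
      lt : r + i < p
      lt = subst (_≤ p) (+-suc r i) le
      next : ∀ {r} → Support r → Occupied f g (suc r)
      next (_ , d , _ , inj₁ (_ , e)) = d , inj₂ e
      next (_ , d , _ , inj₂ (_ , e)) = d , inj₁ e

    -- The cells indexed by a finite type, as the pigeonhole principle requires.
    cell : Fin (x + y) → ℕ
    cell j = [ f ∘ toℕ , g ∘ toℕ ]′ (splitAt x j)

    cell-of : ∀ {r} → 0 < r → Occupied f g r → ∃[ j ] cell j ≡ r
    cell-of 0<r (c , inj₁ refl) = fromℕ< c<x ↑ˡ y ,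
      trans (cong [ f ∘ toℕ , g ∘ toℕ ]′ (splitAt-↑ˡ x (fromℕ< c<x) y)) (cong f (toℕ-fromℕ< c<x))
      where c<x = L.inside⁻¹ 0<r
    cell-of 0<r (c , inj₂ refl) = x ↑ʳ fromℕ< c<y ,
      trans (cong [ f ∘ toℕ , g ∘ toℕ ]′ (splitAt-↑ʳ x y (fromℕ< c<y))) (cong g (toℕ-fromℕ< c<y))
      where c<y = U.inside⁻¹ 0<r

    -- Every row from an occupied one up to row p is occupied, and there are only x + y cells.
    depth-bounded : ∀ {r} → 0 < r → r ≤ p → Occupied f g r → p ∸ r < x + y
    depth-bounded {r} 0<r r≤p o = ≰⇒> λ le → distinct le (pigeonhole ≤-refl (λ i → proj₁ (hit le i)))
      where
      hit : x + y ≤ p ∸ r → (i : Fin (suc (x + y))) → ∃[ j ] cell j ≡ r + toℕ i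
      hit le i = cell-of (≤-trans 0<r (m≤m+n r (toℕ i))) (climb 0<r o (toℕ i)
        (≤-trans (+-monoʳ-≤ r (≤-trans (≤-pred (toℕ<n i)) le)) (≤-reflexive (m+[n∸m]≡n r≤p))))
      distinct : (le : x + y ≤ p ∸ r) → ¬ (∃[ i ] ∃[ j ] (i Fin.< j × proj₁ (hit le i) ≡ proj₁ (hit le j)))
      distinct le (i , j , i<j , e) = <⇒≢ i<j (+-cancelˡ-≡ r _ _
        (trans (sym (proj₂ (hit le i))) (trans (cong cell e) (proj₂ (hit le j)))))

    code-bounded : ∀ {r} → 0 < r → Occupied f g r → code r ≤ x + y
    code-bounded {r} 0<r o with r ≟ q | occupied-value 0<r o
    ... | yes _  | _            = z≤n
    -- The code is the depth plus one, so the strict bound on the depth is exactly this weak bound.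
    ... | no _   | _ , inj₁ r≤p = depth-bounded 0<r r≤p o
    ... | no r≢q | _ , inj₂ r≡q = contradiction r≡q r≢q

    code-supported : ∀ {r} → 0 < r → Occupied f g r → Held (codes f x) (codes g y) (code r)
    code-supported {r} 0<r o with code r in eq
    ... | zero          = tt
    ... | suc zero      = tt
    ... | suc (suc s) with support-below 0<r r<p o
      where
      s<p : suc (suc s) ≤ p
      s<p = subst (_≤ p) eq (code≤p (occupied-value 0<r o))
      r≡ : row (suc (suc s)) ≡ r
      r≡ = trans (cong row (sym eq)) (row-code (occupied-value 0<r o))
      r<p : r < p
      r<p = subst (_< p) r≡ (row-strict {1} s<p (s≤s (s≤s z≤n)))
    ...   | c , d , c≤d , h = lift h
      where
      s<p : suc (suc s) ≤ p
      s<p = subst (_≤ p) eq (code≤p (occupied-value 0<r o))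
      above : suc r ≡ row (suc s)
      above = trans (cong suc (trans (sym (row-code (occupied-value 0<r o))) (cong row eq))) (sym (row-suc (<⇒≤ s<p)))
      code-above : ∀ {v} → Value v → v ≡ suc r → code v ≡ suc s
      code-above h e = code-row h (<⇒≤ s<p) (trans e above)
      lift : f c ≡ r × g d ≡ suc r ⊎ g c ≡ r × f d ≡ suc r →
             Ascent (suc s) (codes f x) (codes g y) ⊎ Ascent (suc s) (codes g y) (codes f x)
      lift (inj₁ (h , h′)) = inj₁ (codes-ascent f g c≤d c<x d<y (trans (cong code h) eq)
                               (code-above (upper-values d<y) h′))
        where
        c<x = L.inside⁻¹ (subst (0 <_) (sym h) 0<r)
        d<y = U.inside⁻¹ (subst (0 <_) (sym h′) (s≤s z≤n))
      lift (inj₂ (h , h′)) = inj₂ (codes-ascent g f c≤d c<y d<x (trans (cong code h) eq)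
                               (code-above (lower-values d<x) h′))
        where
        c<y = U.inside⁻¹ (subst (0 <_) (sym h) 0<r)
        d<x = L.inside⁻¹ (subst (0 <_) (sym h′) (s≤s z≤n))

    codes-valid : Valid (codes f x , codes g y)
    codes-valid = codes-compatible f g x y lower-values upper-values
        (λ c<x → disjoint _ (L.inside c<x))
        (λ c<y lt → L.inside⁻¹ (≤-<-trans z≤n (crossing _ (U.inside c<y) lt)) , crossing _ (U.inside c<y) lt) ,
      codes-All f x (λ c<x → code-supported (L.inside c<x) (_ , inj₁ refl)) ,
      codes-All g y (λ c<y → code-supported (U.inside c<y) (_ , inj₂ refl))

  codes-∈-valids : ∀ {m y f g} → Paths p q (suc m) y f g → (codes f (suc m) , codes g y) ∈ valids m y
  codes-∈-valids {m} {y} {f} {g} P = ∈-filter⁺ valid? (∈-cartesianProduct⁺ lower-∈ upper-∈) (codes-valid (s≤s z≤n) P)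
    where
    open Analysis p<q (s≤s z≤n) P
    vf = lower-values (s≤s z≤n) P
    vg = upper-values (s≤s z≤n) P
    first : code (f 0) ≡ 1
    first = code-row (vf (s≤s z≤n)) 0<p lower-starts
    lower-∈ : codes f (suc m) ∈ map (1 ∷_) (ascending 1 (m + y) m)
    lower-∈ = subst₂ (λ u n → u ∷ codes (f ∘ suc) m ∈ map (1 ∷_) (ascending 1 (m + y) n))
      (sym first) (length-codes (f ∘ suc) m)
      (∈-map⁺ (1 ∷_) (∈-ascending (m + y)
        (codes-linked (f ∘ suc) m (vf ∘ s≤s) (L.descent ∘ s≤s) λ 0<m → subst (_≤ code (f 1)) first
          (code-antitone (vf (s≤s 0<m)) (vf (s≤s z≤n)) (L.descent z≤n)))
        (codes-All (f ∘ suc) m λ c<m → code-bounded (s≤s z≤n) P (L.inside (s≤s c<m)) (_ , inj₁ refl))))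
    upper-∈ : codes g y ∈ ascending 0 (suc m + y) y
    upper-∈ = subst (λ n → codes g y ∈ ascending 0 (suc m + y) n) (length-codes g y)
      (∈-ascending (suc m + y) (codes-linked g y vg U.descent λ _ → z≤n)
        (codes-All g y λ c<y → code-bounded (s≤s z≤n) P (U.inside c<y) (_ , inj₂ refl)))

  separated⇒determined : ∀ m y → Separated m y → Determined p q (suc m) y
  separated⇒determined m y sep {f} {g} {f′} {g′} P P′ sw = Pair.lower-determines P P′ sw f≡f′
    where
    module L  = Path (Paths.lower P)
    module L′ = Path (Paths.lower P′)
    weight-codes : ∀ {f g} → Paths p q (suc m) y f g → ∀ {s} → s ≤ p →
      occurrences s (codes f (suc m)) + occurrences s (codes g y) ≡ weight f g (suc m + y) (row s)
    weight-codes {f} {g} P s≤p = cong₂ _+_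
      (trans (occurrences-codes f (suc m) (lower-values (s≤s z≤n) P) s≤p)
        (sym (count-stable (Paths.lower P) (m≤m+n (suc m) y) (row-positive s≤p))))
      (trans (occurrences-codes g y (upper-values (s≤s z≤n) P) s≤p)
        (sym (count-stable (Paths.upper P) (m≤n+m y (suc m)) (row-positive s≤p))))
    weight-above-codes : ∀ {f g} → Paths p q (suc m) y f g → ∀ {s} → p < s →
      occurrences s (codes f (suc m)) + occurrences s (codes g y) ≡ 0
    weight-above-codes {f} {g} P p<s = cong₂ _+_
      (occurrences-codes-above f (suc m) (lower-values (s≤s z≤n) P) p<s)
      (occurrences-codes-above g y (upper-values (s≤s z≤n) P) p<s)
    same : ∀ s → occurrences s (codes f (suc m)) + occurrences s (codes g y)
               ≡ occurrences s (codes f′ (suc m)) + occurrences s (codes g′ y)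
    same s with s ≤? p
    ... | yes s≤p = trans (weight-codes P s≤p) (trans (sw (row s) (row-positive s≤p)) (sym (weight-codes P′ s≤p)))
    ... | no  s≰p = trans (weight-above-codes P (≰⇒> s≰p)) (sym (weight-above-codes P′ (≰⇒> s≰p)))
    codes≡ : codes f (suc m) ≡ codes f′ (suc m)
    codes≡ = All.lookup (All.lookup sep (codes-∈-valids P)) (codes-∈-valids P′)
      (All.tabulate λ {s} _ → same s)
    f≡f′ : ∀ c → f c ≡ f′ c
    f≡f′ c with c <? suc m
    ... | yes c<x = codes-injective (lower-values (s≤s z≤n) P) (lower-values (s≤s z≤n) P′) codes≡ c<x
    ... | no  c≮x = trans (L.outside (≮⇒≥ c≮x)) (sym (L′.outside (≮⇒≥ c≮x)))

-- Classification of the shapes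

data MultiplicityFreeShape : ℕ → ℕ → Set where
  three-three : MultiplicityFreeShape 3 3
  four-four   : MultiplicityFreeShape 4 4
  four-three  : MultiplicityFreeShape 4 3
  upper-one   : ∀ {x} → 0 < x → MultiplicityFreeShape x 1
  lower-one   : ∀ {y} → 0 < y → MultiplicityFreeShape 1 y
  upper-two   : ∀ {x} → 2 ≤ x → MultiplicityFreeShape x 2
  lower-two   : ∀ {y} → 2 ≤ y → MultiplicityFreeShape 2 y

shape⇒determined : ∀ {p q x y} → p < q → MultiplicityFreeShape x y → Determined p q x y
shape⇒determined p<q three-three     = Coding.separated⇒determined _ _ p<q 2 3 separated-3-3
shape⇒determined p<q four-four       = Coding.separated⇒determined _ _ p<q 3 4 separated-4-4
shape⇒determined p<q four-three      = Coding.separated⇒determined _ _ p<q 3 3 separated-4-3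
shape⇒determined p<q (upper-one 0<x) = determined-x-1 p<q 0<x
shape⇒determined p<q (lower-one _)   = determined-1-y p<q
shape⇒determined p<q (upper-two 2≤x) = determined-x-2 p<q 2≤x
shape⇒determined p<q (lower-two 2≤y) = determined-2-y p<q 2≤y

classify : ∀ x y → 0 < x → 0 < y → MultiplicityFreeShape x y ⊎ NonMultiplicityFree x y
classify 1 (suc y) _ _ = inj₁ (lower-one (s≤s z≤n))
classify (suc (suc x)) 1 _ _ = inj₁ (upper-one (s≤s z≤n))
classify 2 (suc (suc y)) _ _ = inj₁ (lower-two (s≤s (s≤s z≤n)))
classify (suc (suc (suc x))) 2 _ _ = inj₁ (upper-two (s≤s (s≤s z≤n)))
-- Here x and y are the parts minus 3. Equal parts 3 and 4 and the pair (4,3), which is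
-- `greater zero 0`, are the sporadic shapes; all the rest lie in a family.
classify (suc (suc (suc x))) (suc (suc (suc y))) _ _ with compare x y
... | less m k            = inj₂ (subst₂ NonMultiplicityFree (+-comm m 3) (shift m 4 k) (long-upper m k))
  where
  shift : ∀ m n k → m + (n + k) ≡ n + (m + k)
  shift m n k = trans (sym (+-assoc m n k)) (trans (cong (_+ k) (+-comm m n)) (+-assoc n m k))
... | equal 0             = inj₁ three-three
... | equal 1             = inj₁ four-four
... | equal (suc (suc m)) = inj₂ (subst (λ n → NonMultiplicityFree n n) (+-comm m 5) (same-length m))
... | greater zero    0   = inj₁ four-three
... | greater (suc m) 0   = inj₂ (subst₂ NonMultiplicityFree
      (trans (+-comm m 5) (cong (5 +_) (sym (+-identityʳ m)))) (+-comm m 4) (lower-by-one m))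
... | greater m (suc k)   = inj₂ (subst₂ NonMultiplicityFree (shift m k) (+-comm m 3) (long-lower m k))
  where
  shift : ∀ m k → m + (5 + k) ≡ 4 + (m + suc k)
  shift m k = trans (sym (+-assoc m 4 (suc k))) (trans (cong (_+ suc k) (+-comm m 4)) (+-assoc 4 m (suc k)))

determined⇒shape : ∀ {p q x y} → p < q → 3 ≤ p → 0 < x → 0 < y → Determined p q x y → MultiplicityFreeShape x y
determined⇒shape {p} {q} {x} {y} p<q 3≤p 0<x 0<y det with classify x y 0<x 0<y
... | inj₁ shape = shape
... | inj₂ non   = ⊥-elim (Undetermined.nonMultiplicityFree⇒¬determined p q p<q 3≤p non det)

sortDesc-pair : ∀ x y → sortDesc (x ∷ y ∷ []) ≡ x ∷ y ∷ [] × y ≤ x ⊎ sortDesc (x ∷ y ∷ []) ≡ y ∷ x ∷ [] × x ≤ y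
sortDesc-pair x y with y ≤ᵇ x in eq
... | true  = inj₁ (refl , ≤ᵇ⇒≤ y x (subst T (sym eq) tt))
... | false = inj₂ (refl , ≰⇒≥ λ h → subst T eq (≤⇒≤ᵇ h))

sortDesc-desc : ∀ {x y} → y ≤ x → sortDesc (x ∷ y ∷ []) ≡ x ∷ y ∷ []
sortDesc-desc {x} {y} y≤x with sortDesc-pair x y
... | inj₁ (e , _)   = e
... | inj₂ (e , x≤y) with refl ← ≤-antisym x≤y y≤x = e

sortDesc-asc : ∀ {x y} → x ≤ y → sortDesc (x ∷ y ∷ []) ≡ y ∷ x ∷ []
sortDesc-asc {x} {y} x≤y with sortDesc-pair x y
... | inj₁ (e , y≤x) with refl ← ≤-antisym x≤y y≤x = e
... | inj₂ (e , _)   = e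

pair-injective : ∀ {x y u v : ℕ} → _≡_ {A = List ℕ} (x ∷ y ∷ []) (u ∷ v ∷ []) → x ≡ u × y ≡ v
pair-injective refl = refl , refl

sortDesc-parts : ∀ {x y u v} → sortDesc (x ∷ y ∷ []) ≡ u ∷ v ∷ [] → x ≡ u × y ≡ v ⊎ y ≡ u × x ≡ v
sortDesc-parts {x} {y} e with sortDesc-pair x y
... | inj₁ (e′ , _) = inj₁ (pair-injective (trans (sym e′) e))
... | inj₂ (e′ , _) = inj₂ (pair-injective (trans (sym e′) e))

-- `sortC a` unfolds to `sortDesc (flat a)`, so the right-hand side of the theorem is
-- `Listed (flat a)` by definition, and the two parts can be substituted for `flat a`.
Listed : List ℕ → Set
Listed ps = (sortDesc ps ≡ 3 ∷ 3 ∷ []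
             ⊎ sortDesc ps ≡ 4 ∷ 4 ∷ []
             ⊎ (∃[ n ] (4 ≤ n × sortDesc ps ≡ (n ∸ 2) ∷ 2 ∷ []))
             ⊎ (∃[ n ] (2 ≤ n × sortDesc ps ≡ (n ∸ 1) ∷ 1 ∷ [])))
            ⊎ ps ≡ 4 ∷ 3 ∷ []

shape⇒listed : ∀ {x y} → MultiplicityFreeShape x y → Listed (x ∷ y ∷ [])
shape⇒listed three-three         = inj₁ (inj₁ refl)
shape⇒listed four-four           = inj₁ (inj₂ (inj₁ refl))
shape⇒listed four-three          = inj₂ refl
shape⇒listed (upper-two {x} 2≤x) = inj₁ (inj₂ (inj₂ (inj₁ (2 + x , +-monoʳ-≤ 2 2≤x , sortDesc-desc 2≤x))))
shape⇒listed (lower-two {y} 2≤y) = inj₁ (inj₂ (inj₂ (inj₁ (2 + y , +-monoʳ-≤ 2 2≤y , sortDesc-asc 2≤y))))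
shape⇒listed (upper-one {x} 0<x) = inj₁ (inj₂ (inj₂ (inj₂ (1 + x , s≤s 0<x , sortDesc-desc 0<x))))
shape⇒listed (lower-one {y} 0<y) = inj₁ (inj₂ (inj₂ (inj₂ (1 + y , s≤s 0<y , sortDesc-asc 0<y))))

listed⇒shape : ∀ {x y} → Listed (x ∷ y ∷ []) → MultiplicityFreeShape x y
listed⇒shape (inj₁ (inj₁ e)) with sortDesc-parts e
... | inj₁ (refl , refl) = three-three
... | inj₂ (refl , refl) = three-three
listed⇒shape (inj₁ (inj₂ (inj₁ e))) with sortDesc-parts e
... | inj₁ (refl , refl) = four-four
... | inj₂ (refl , refl) = four-four
-- Matching twice on 4 ≤ n exposes two successors, so n ∸ 2 computes and 2 ≤ n ∸ 2 is what remains.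
listed⇒shape (inj₁ (inj₂ (inj₂ (inj₁ (_ , s≤s (s≤s 2≤n) , e))))) with sortDesc-parts e
... | inj₁ (refl , refl) = upper-two 2≤n
... | inj₂ (refl , refl) = lower-two 2≤n
listed⇒shape (inj₁ (inj₂ (inj₂ (inj₂ (_ , s≤s 1≤n , e))))) with sortDesc-parts e
... | inj₁ (refl , refl) = upper-one 1≤n
... | inj₂ (refl , refl) = lower-one 1≤n
listed⇒shape (inj₂ refl) = four-three

flat-positive : ∀ a → All (0 <_) (flat a)
flat-positive []          = []
flat-positive (zero ∷ a)  = flat-positive a
flat-positive (suc _ ∷ a) = s≤s z≤n ∷ flat-positive a

theorem5p4 : (b : WeakComposition) → let a = 0 ∷ 0 ∷ b in
    length (flat a) ≡ 2 →
    (MultiplicityFree a ⇔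
    ((sortC a ≡ 3 ∷ 3 ∷ []
    ⊎ sortC a ≡ 4 ∷ 4 ∷ []
    ⊎ (∃[ n ] (4 ≤ n × sortC a ≡ (n ∸ 2) ∷ 2 ∷ []))
    ⊎ (∃[ n ] (2 ≤ n × sortC a ≡ (n ∸ 1) ∷ 1 ∷ [])))
    ⊎ flat a ≡ 4 ∷ 3 ∷ []))
theorem5p4 b len = go (flat b) refl len
  where
  a = 0 ∷ 0 ∷ b
  -- The parts in positions 1 and 2 of a compute to 0, while the part at p is positive.
  above-two : ∀ {p q x y} → TwoParts a p q x y → 0 < x → 3 ≤ p
  above-two {1}                 parts 0<x = contradiction (TwoParts.at-p parts) (<⇒≢ 0<x)
  above-two {2}                 parts 0<x = contradiction (TwoParts.at-p parts) (<⇒≢ 0<x)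
  above-two {suc (suc (suc p))} _     _   = s≤s (s≤s (s≤s z≤n))
  above-two {0}                 parts _   = contradiction (TwoParts.1≤p parts) λ ()
  go : ∀ ps → flat a ≡ ps → length ps ≡ 2 → MultiplicityFree a ⇔ Listed (flat a)
  go (x ∷ y ∷ []) e _ with flat≡[x,y] a e | subst (All (0 <_)) e (flat-positive a)
  ... | p , q , parts | 0<x ∷ 0<y ∷ [] = mk⇔
    (λ mf → subst Listed (sym e) (shape⇒listed
      (determined⇒shape p<q (above-two parts 0<x) 0<x 0<y (M.to mf))))
    (λ listed → M.from (shape⇒determined p<q (listed⇒shape (subst Listed e listed))))
    where
    open TwoParts parts using (p<q)
    module M = Equivalence (MultiplicityFreeness.multiplicityFree⇔determined a p q x y parts)
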